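{- For every integer $n\ge 1$ and all integers $r,k\in\mathbb{Z}$, $$\begin{aligned} s_{n}^{(r,k)}(x)={}&-r\,s_{n-1}^{(r,k)}(x)+r\sum_{l=0}^{n-1}\frac{\binom{n-1}{l}}{(n+1-l)(n-l)}\,s_{l}^{(r+1,k)}(x)\\ &+\sum_{l=0}^{n-1}\left\{(-1)^{n-1-l}\binom{n-1}{l}\sum_{m=0}^{n-1-l}(-1)^{m}\frac{(m+1)!}{(m+2)^{k}}S_{2}(n-1-l,m)\right\}\mathbb{B}_{l}^{(r)}(x-1)\\ &+x\,s_{n-1}^{(r,k)}(x) \end{aligned}$$ as polynomials in $x$.
   Context: For $k\in\mathbb{Z}$, $Li_k(x)=\sum_{n=1}^{\infty}\frac{x^n}{n^k}$ is the polylogarithm, regarded as a formal power series; $\frac{Li_k(1-e^{ -t})}{1-e^{ -t}}$ is then a formal power series in $t$ over $\mathbb{C}$. For $r\in\mathbb{Z}$, the Bernoulli polynomials of order $r$, $\mathbb{B}_n^{(r)}(x)$, are defined by $\left(\frac{t}{e^t-1}\right)^r e^{xt}=\sum_{n\ge0}\mathbb{B}_n^{(r)}(x)\frac{t^n}{n!}$. For $r,k\in\mathbb{Z}$, the higher-order Bernoulli and poly-Bernoulli mixed type polynomials $s_n^{(r,k)}(x)$ are defined by $\left(\frac{t}{e^t-1}\right)^r\frac{Li_k(1-e^{ -t})}{1-e^{ -t}}e^{xt}=\sum_{n\ge0}s_n^{(r,k)}(x)\frac{t^n}{n!}$. $S_2(n,m)$ denotes the Stirling number of the second kind (with $S_2(0,0)=1$).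 -}

module Defs where

open import Algebra.Apartness.Bundles using (HeytingField; HeytingCommutativeRing)
open import Algebra.Bundles using (CommutativeRing)
open import Algebra.Bundles.Raw using (RawRing)
import Algebra.Definitions.RawMonoid as RawMonoidDefs
import Algebra.Definitions.RawSemiring as RawSemiringDefs
open import Data.Fin.Base using (toℕ)
open import Data.Integer.Base as ℤ using (ℤ; +_; -[1+_])
open import Data.List.Base using (List; []; _∷_; map)
open import Data.Nat.Base as ℕ using (ℕ; zero; suc; _∸_; _!)
open import Data.Product.Base using (proj₁)

-- Stirling numbers of the second kind.
S₂ : ℕ → ℕ → ℕ
S₂ zero    zero    = 1
S₂ zero    (suc m) = 0
S₂ (suc n) zero    = 0
S₂ (suc n) (suc m) = suc m ℕ.* S₂ n (suc m) ℕ.+ S₂ n m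

module Sums {c ℓ} (R : RawRing c ℓ) where
  open RawRing R

  -- The index i ranges over 0 ≤ i < n.
  ∑-below : ℕ → (ℕ → Carrier) → Carrier
  ∑-below n f = RawMonoidDefs.sum +-rawMonoid {n} (λ i → f (toℕ i))

  syntax ∑-below n (λ i → a) = ∑[ i < n ] a

-- Formal power series; f n is the coefficient of the n-th power.
module PowerSeries {c ℓ} (R : RawRing c ℓ) where
  open RawRing R
  open Sums R

  Series : Set c
  Series = ℕ → Carrier

  constant : Carrier → Series
  constant a zero    = a
  constant a (suc n) = 0#

  variableˢ : Series
  variableˢ zero          = 0#
  variableˢ (suc zero)    = 1#
  variableˢ (suc (suc n)) = 0#

  powerSeriesRing : RawRing c ℓ
  powerSeriesRing = record
    { Carrier = Series
    ; _≈_     = λ f g → ∀ n → f n ≈ g n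
    ; _+_     = λ f g n → f n + g n
    ; _*_     = λ f g n → ∑[ i < suc n ] (f i * g (n ∸ i))
    ; -_      = λ f n → - f n
    ; 0#      = constant 0#
    ; 1#      = constant 1#
    }

  private
    module S where
      open RawRing powerSeriesRing public
      open RawSemiringDefs (RawRing.rawSemiring powerSeriesRing) public using (_^_)

  -- a (h (t)) = Σ aₘ h(t)ᵐ, for h with zero constant term: then hᵐ does not
  -- contribute to the coefficient of tⁿ when m > n.
  compose : Series → Series → Series
  compose a h n = ∑[ m < suc n ] (a m * (h S.^ m) n)

  -- 1 / f = Σ (1 − f)ᵐ, for f with constant term 1.
  recip : Series → Series
  recip f = compose (λ _ → 1#) (S.1# S.+ S.- f)

  -- f / g, for f with zero constant term and g = t + O(t²): cancel a factor t
  -- from both, which leaves a denominator with constant term 1.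
  infixl 7 _/ˢ_
  _/ˢ_ : Series → Series → Series
  f /ˢ g = (λ n → f (suc n)) S.* recip (λ n → g (suc n))

  -- Integer powers of a series with constant term 1.
  infixr 8 _^ˢ_
  _^ˢ_ : Series → ℤ → Series
  f ^ˢ (+ n)    = f S.^ n
  f ^ˢ -[1+ n ] = recip f S.^ suc n

-- Polynomials as lists of coefficients, lowest degree first.  Trailing zeros are
-- allowed, so equality compares all coefficients.
module Polynomials {c ℓ} (R : RawRing c ℓ) where
  open RawRing R

  infix  4 _≈ᵖ_
  infixl 6 _+ᵖ_
  infixl 7 _*ᵖ_
  infixr 7 _·_

  Polynomial : Set c
  Polynomial = List Carrier

  coeff : Polynomial → ℕ → Carrier
  coeff []      n       = 0#
  coeff (a ∷ p) zero    = a
  coeff (a ∷ p) (suc n) = coeff p n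

  _≈ᵖ_ : Polynomial → Polynomial → Set ℓ
  p ≈ᵖ q = ∀ n → coeff p n ≈ coeff q n

  C : Carrier → Polynomial
  C a = a ∷ []

  X : Polynomial
  X = 0# ∷ 1# ∷ []

  _+ᵖ_ : Polynomial → Polynomial → Polynomial
  []      +ᵖ q       = q
  (a ∷ p) +ᵖ []      = a ∷ p
  (a ∷ p) +ᵖ (b ∷ q) = (a + b) ∷ (p +ᵖ q)

  _·_ : Carrier → Polynomial → Polynomial
  a · p = map (a *_) p

  _*ᵖ_ : Polynomial → Polynomial → Polynomial
  []      *ᵖ q = []
  (a ∷ p) *ᵖ q = (a · q) +ᵖ (0# ∷ (p *ᵖ q))

  -- p ⟨ q ⟩ is p (q (x)).
  infixl 9 _⟨_⟩
  _⟨_⟩ : Polynomial → Polynomial → Polynomial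
  []      ⟨ q ⟩ = []
  (a ∷ p) ⟨ q ⟩ = C a +ᵖ q *ᵖ p ⟨ q ⟩

  polynomialRing : RawRing c ℓ
  polynomialRing = record
    { Carrier = Polynomial
    ; _≈_     = _≈ᵖ_
    ; _+_     = _+ᵖ_
    ; _*_     = _*ᵖ_
    ; -_      = map -_
    ; 0#      = []
    ; 1#      = C 1#
    }

module _ {c ℓ₁ ℓ₂} (K : HeytingField c ℓ₁ ℓ₂) where
  open HeytingField K

  fieldRing : RawRing c ℓ₁
  fieldRing = CommutativeRing.rawRing
    (HeytingCommutativeRing.commutativeRing (HeytingField.heytingCommutativeRing K))

  ι : ℕ → Carrier
  ι n = RawMonoidDefs._×_ (RawRing.+-rawMonoid fieldRing) n 1#

  CharacteristicZero : Set ℓ₂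
  CharacteristicZero = ∀ n → ι (suc n) # 0#

module MixedType {c ℓ₁ ℓ₂} (K : HeytingField c ℓ₁ ℓ₂) (char0 : CharacteristicZero K) where

  open HeytingField K public using (Carrier; _≈_; _+_; _*_; -_; 0#; 1#)
  open HeytingField K using (#⇒invertible)
  open RawSemiringDefs (RawRing.rawSemiring (fieldRing K)) public using (_^_)
  open Sums (fieldRing K) public
  open Polynomials (fieldRing K) public

  ∑ᵖ-below : ℕ → (ℕ → Polynomial) → Polynomial
  ∑ᵖ-below = Sums.∑-below polynomialRing

  syntax ∑ᵖ-below n (λ i → p) = ∑ᵖ[ i < n ] p

  fromℕ : ℕ → Carrier
  fromℕ = ι K

  fromℤ : ℤ → Carrier
  fromℤ (+ n)    = fromℕ n
  fromℤ -[1+ n ] = - fromℕ (suc n)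

  -- Reciprocal of a positive integer; the value at 0 is arbitrary and unused.
  1/_ : ℕ → Carrier
  1/ zero  = 0#
  1/ suc n = proj₁ (#⇒invertible (char0 n))

  -- Integer powers of a positive integer.
  infixr 8 _^ᶻ_
  _^ᶻ_ : ℕ → ℤ → Carrier
  n ^ᶻ (+ k)    = fromℕ n ^ k
  n ^ᶻ -[1+ k ] = (1/ n) ^ suc k

  module K⟦t⟧ where
    open PowerSeries (fieldRing K) public
    open RawRing powerSeriesRing public
      using () renaming (_+_ to _+ˢ_; _*_ to _*ˢ_; -_ to -ˢ_; 1# to 1ˢ)

  module K[x]⟦t⟧ where
    open PowerSeries polynomialRing public
    open RawRing powerSeriesRing public using () renaming (_*_ to _*ˢ_)

  open K⟦t⟧

  t : Series
  t = variableˢ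

  -- e^{at}
  exp : Carrier → Series
  exp a n = (1/ (n !)) * a ^ n

  -- e^{xt}, with coefficients in K[x]
  exp-xt : K[x]⟦t⟧.Series
  exp-xt n = (1/ (n !)) · X ^ᵖ n
    where open RawSemiringDefs (RawRing.rawSemiring polynomialRing) using () renaming (_^_ to _^ᵖ_)

  embed : Series → K[x]⟦t⟧.Series
  embed f n = C (f n)

  Li : ℤ → Series
  Li k zero    = 0#
  Li k (suc n) = suc n ^ᶻ (ℤ.- k)

  -- t / (e^t − 1)
  bernoulliSeries : Series
  bernoulliSeries = t /ˢ (exp 1# +ˢ -ˢ 1ˢ)

  -- Li_k(1 − e^{−t}) / (1 − e^{−t})
  polyBernoulliSeries : ℤ → Series
  polyBernoulliSeries k = compose (Li k) y /ˢ y
    where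
    y : Series
    y = 1ˢ +ˢ -ˢ exp (- 1#)

  -- The sequence aₙ with F = Σ aₙ tⁿ / n!
  egfCoeff : K[x]⟦t⟧.Series → ℕ → Polynomial
  egfCoeff F n = fromℕ (n !) · F n

  -- 𝔹 r n and s r k n stand for 𝔹_n^(r)(x) and s_n^(r,k)(x).
  𝔹 : ℤ → ℕ → Polynomial
  𝔹 r = egfCoeff (embed (bernoulliSeries ^ˢ r) K[x]⟦t⟧.*ˢ exp-xt)

  s : ℤ → ℤ → ℕ → Polynomial
  s r k = egfCoeff (embed ((bernoulliSeries ^ˢ r) *ˢ polyBernoulliSeries k) K[x]⟦t⟧.*ˢ exp-xt)

-- Differentiate F = bʳ p eˣᵗ in t, where b = t/(eᵗ−1), y = 1 − e⁻ᵗ and p = Li_k(y)/y.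
-- Since b⁻¹ = (eᵗ−1)/t satisfies (b⁻¹)′ = b⁻¹ − e₂ with e₂ = (eᵗ−1−t)/t², one gets
-- (bʳ)′ = r (e₂ bʳ⁺¹ − bʳ) for every integer r; and p = Σ yᵐ/(m+1)ᵏ with y′ = e⁻ᵗ gives
-- p′ = e⁻ᵗ Σ (m+1) yᵐ/(m+2)ᵏ.  Hence
--   F′ = − r F + r e₂ (bʳ⁺¹ p eˣᵗ) + (Σ (m+1) yᵐ/(m+2)ᵏ) (bʳ e⁽ˣ⁻¹⁾ᵗ) + x F,
-- and the four terms of the recurrence are the coefficients of tⁿ⁻¹/(n−1)!, the Stirling
-- numbers entering through the coefficients of yᵐ.
module Submission where

open import Algebra.Apartness.Bundles using (HeytingField; HeytingCommutativeRing)
open import Algebra.Bundles using (CommutativeRing)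
open import Algebra.Bundles.Raw using (RawRing)
import Algebra.Definitions.RawSemiring as RawSemiringDefs
open import Algebra.Morphism.Structures using (IsRingMonomorphism)
import Algebra.Morphism.RingMonomorphism as RingMonomorphism
import Algebra.Properties.CommutativeMonoid.Mult as CommutativeMonoidMult
import Algebra.Properties.CommutativeSemigroup as CommutativeSemigroupProperties
import Algebra.Properties.Group as GroupProperties
import Algebra.Properties.Ring as RingProperties
import Algebra.Properties.Semiring.Mult as SemiringMult
import Algebra.Solver.Ring.NaturalCoefficients.Default as SemiringSolver
open import Data.Integer.Base as ℤ using (ℤ; +_; -[1+_]; 1ℤ)
open import Data.List.Base using ([]; _∷_; map)
open import Data.Nat.Base as ℕ using (ℕ; zero; suc; _∸_; _≤_; _<_; _≥_; z≤n; s≤s; NonZero; _!)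
open import Data.Nat.Combinatorics using (nCk≡n!/k![n-k]!; k![n∸k]!∣n!) renaming (_C_ to binom)
open import Data.Nat.DivMod using (m/n*n≡m)
open import Data.Nat.Properties as ℕ using (_!≢0; _!*_!≢0; m*n≢0)
open import Data.Product.Base using (_,_; proj₂)
open import Level using (_⊔_)
import Relation.Binary.Reasoning.Setoid as ≈-Reasoning
open import Relation.Binary.PropositionalEquality as ≡ using (_≡_)
open import Defs

-- Only `exp-xt` has coefficients that involve x, so the differential equation of bʳ p is proved
-- over K and carried coefficientwise into K[x]⟦t⟧ by `embed`. Two encodings stand in the way of
-- calculus. The range of the sum in `compose` grows with the coefficient index, so each coefficient
-- is compared with a `combination` of a fixed, sufficient length; this yields both the chain rule
-- and f · `recip` f = 1. Moreover `_^ˢ_` takes negative powers of `recip b`, where b is itself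
-- given by a `recip`; that `recip b` is (eᵗ-1)/t comes from uniqueness of inverses. The argument x
-- - 1 arises from the factor e⁻ᵗ of y′, which is moved next to bʳ; e⁻ᵗ eˣᵗ = e⁽ˣ⁻¹⁾ᵗ is obtained by
-- uniqueness of the solution of F′ = (x-1) F, which rests on characteristic zero. Differential
-- equations are kept free of subtraction, so that their algebra is that of commutative semirings.

module SumProperties {c ℓ} (R : CommutativeRing c ℓ) where
  open CommutativeRing R
  open Sums rawRing

  ∑-cong : ∀ n {f g} → (∀ i → i < n → f i ≈ g i) → ∑-below n f ≈ ∑-below n g
  ∑-cong zero    f≈g = refl
  ∑-cong (suc n) f≈g = +-cong (f≈g 0 (s≤s z≤n)) (∑-cong n λ i i<n → f≈g (suc i) (s≤s i<n))

  ∑-zero : ∀ n {f} → (∀ i → i < n → f i ≈ 0#) → ∑-below n f ≈ 0#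
  ∑-zero zero    f≈0 = refl
  ∑-zero (suc n) {f} f≈0 = trans
    (+-cong (f≈0 0 (s≤s z≤n)) (∑-zero n {λ i → f (suc i)} λ i i<n → f≈0 (suc i) (s≤s i<n)))
    (+-identityˡ 0#)

  *-distribˡ-∑ : ∀ n a f → a * ∑-below n f ≈ ∑[ i < n ] (a * f i)
  *-distribˡ-∑ zero    a f = zeroʳ a
  *-distribˡ-∑ (suc n) a f = trans (distribˡ _ _ _) (+-congˡ (*-distribˡ-∑ n a λ i → f (suc i)))

  ∑-truncate : ∀ {m n} {f : ℕ → Carrier} → m ≤ n → (∀ i → m ≤ i → f i ≈ 0#) →
               ∑-below n f ≈ ∑-below m f
  ∑-truncate {n = n} {f = f} z≤n f≈0 = ∑-zero n λ i _ → f≈0 i z≤n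
  ∑-truncate {f = f} (s≤s m≤n)   f≈0 =
    +-congˡ (∑-truncate {f = λ i → f (suc i)} m≤n λ i m≤i → f≈0 (suc i) (s≤s m≤i))

record IsDerivation {c ℓ} (A : CommutativeRing c ℓ)
                    (∂ : CommutativeRing.Carrier A → CommutativeRing.Carrier A) : Set (c ⊔ ℓ) where
  open CommutativeRing A
  field
    ∂-cong : ∀ x y → x ≈ y → ∂ x ≈ ∂ y
    ∂-*    : ∀ x y → ∂ (x * y) ≈ ∂ x * y + x * ∂ y

-- Formal power series: the commutative ring and its derivation.

module SeriesRing {c ℓ} (R : CommutativeRing c ℓ) where
  open CommutativeRing R
  open SemiringMult semiring using (_×_; ×-congʳ; ×-comm-*)
  open CommutativeMonoidMult +-commutativeMonoid using (×-distrib-+)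
  open Sums rawRing
  open SumProperties R
  open PowerSeries rawRing
  open RawRing powerSeriesRing using ()
    renaming (_≈_ to _≈ˢ_; _+_ to _+ˢ_; _*_ to _*ˢ_; -_ to -ˢ_; 0# to 0ˢ; 1# to 1ˢ)
  open SemiringSolver commutativeSemiring using (solve; _:+_; _:*_; _:=_; con)
  open ≈-Reasoning setoid

  tail : Series → Series
  tail f n = f (suc n)

  scale : Carrier → Series → Series
  scale a f n = a * f n

  constant-0 : ∀ n → 0ˢ n ≈ 0#
  constant-0 zero    = refl
  constant-0 (suc n) = refl

  -- Locality of the product: its coefficient at `n` sees only coefficients up to `n`. This is what
  -- lets a truncation replace a whole series in `*ˢ-compose`.
  *ˢ-cong-≤ : ∀ {f f′ g g′} n → (∀ i → i ≤ n → f i ≈ f′ i) → (∀ i → i ≤ n → g i ≈ g′ i) →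
              (f *ˢ g) n ≈ (f′ *ˢ g′) n
  *ˢ-cong-≤ n f≈f′ g≈g′ =
    ∑-cong (suc n) λ i i≤n → *-cong (f≈f′ i (ℕ.s≤s⁻¹ i≤n)) (g≈g′ (n ∸ i) (ℕ.m∸n≤m n i))

  *ˢ-cong : ∀ f f′ g g′ → f ≈ˢ f′ → g ≈ˢ g′ → (f *ˢ g) ≈ˢ (f′ *ˢ g′)
  *ˢ-cong f f′ g g′ f≈f′ g≈g′ n = *ˢ-cong-≤ {f} {f′} {g} {g′} n (λ i _ → f≈f′ i) (λ i _ → g≈g′ i)

  *ˢ-vanishˡ : ∀ f g n → (∀ i → i ≤ n → f i ≈ 0#) → (f *ˢ g) n ≈ 0#
  *ˢ-vanishˡ f g n f≈0 =
    ∑-zero (suc n) λ i i≤n → trans (*-congʳ (f≈0 i (ℕ.s≤s⁻¹ i≤n))) (zeroˡ (g (n ∸ i)))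

  -- By computation, `(f *ˢ g) (suc n)` is `f 0 * g (suc n) + (tail f *ˢ g) n`. This recursion,
  -- which shortens the left factor, drives the inductions on products.
  *ˢ-distribʳ : ∀ h f g → ((f +ˢ g) *ˢ h) ≈ˢ ((f *ˢ h) +ˢ (g *ˢ h))
  *ˢ-distribʳ h f g zero    =
    solve 3 (λ a b c → (a :+ b) :* c :+ con 0 := a :* c :+ con 0 :+ (b :* c :+ con 0)) refl (f 0) (g 0) (h 0)
  *ˢ-distribʳ h f g (suc n) = trans (+-congˡ (*ˢ-distribʳ h (tail f) (tail g) n))
    (solve 5 (λ a b c x y → (a :+ b) :* c :+ (x :+ y) := a :* c :+ x :+ (b :* c :+ y)) refl
      (f 0) (g 0) (h (suc n)) ((tail f *ˢ h) n) ((tail g *ˢ h) n))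

  *ˢ-scaleˡ : ∀ a f g → (scale a f *ˢ g) ≈ˢ scale a (f *ˢ g)
  *ˢ-scaleˡ a f g zero    =
    solve 3 (λ a b c → a :* b :* c :+ con 0 := a :* (b :* c :+ con 0)) refl a (f 0) (g 0)
  *ˢ-scaleˡ a f g (suc n) = trans (+-congˡ (*ˢ-scaleˡ a (tail f) g n))
    (solve 4 (λ a b c x → a :* b :* c :+ a :* x := a :* (b :* c :+ x)) refl
      a (f 0) (g (suc n)) ((tail f *ˢ g) n))

  -- The recursion exposes `tail (f *ˢ g)` as `scale (f 0) (tail g) +ˢ (tail f *ˢ g)`, which is why
  -- distributivity and scaling come before associativity.
  *ˢ-assoc : ∀ f g h → ((f *ˢ g) *ˢ h) ≈ˢ (f *ˢ (g *ˢ h))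
  *ˢ-assoc f g h zero    =
    solve 3 (λ a b c → (a :* b :+ con 0) :* c :+ con 0 := a :* (b :* c :+ con 0) :+ con 0) refl
      (f 0) (g 0) (h 0)
  *ˢ-assoc f g h (suc n) = begin
    (f 0 * g 0 + 0#) * h (suc n) + ((scale (f 0) (tail g) +ˢ (tail f *ˢ g)) *ˢ h) n
      ≈⟨ +-congˡ (*ˢ-distribʳ h (scale (f 0) (tail g)) (tail f *ˢ g) n) ⟩
    (f 0 * g 0 + 0#) * h (suc n) + ((scale (f 0) (tail g) *ˢ h) n + ((tail f *ˢ g) *ˢ h) n)
      ≈⟨ +-congˡ (+-cong (*ˢ-scaleˡ (f 0) (tail g) h n) (*ˢ-assoc (tail f) g h n)) ⟩
    (f 0 * g 0 + 0#) * h (suc n) + (f 0 * (tail g *ˢ h) n + (tail f *ˢ (g *ˢ h)) n)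
      ≈⟨ solve 5 (λ a b c x y → (a :* b :+ con 0) :* c :+ (a :* x :+ y) := a :* (b :* c :+ x) :+ y) refl
           (f 0) (g 0) (h (suc n)) ((tail g *ˢ h) n) ((tail f *ˢ (g *ˢ h)) n) ⟩
    f 0 * (g 0 * h (suc n) + (tail g *ˢ h) n) + (tail f *ˢ (g *ˢ h)) n ∎

  -- Only the left factor can be peeled, so one term is peeled from each side with a swap in
  -- between, and the common remainder is `tail f *ˢ tail g` at index `n`. The two peelings require
  -- separate cases for indices 0 and 1.
  *ˢ-comm : ∀ f g → (f *ˢ g) ≈ˢ (g *ˢ f)
  *ˢ-comm f g zero          = +-congʳ (*-comm _ _)
  *ˢ-comm f g (suc zero)    =
    solve 4 (λ a b c d → a :* b :+ (c :* d :+ con 0) := d :* c :+ (b :* a :+ con 0)) refl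
      (f 0) (g 1) (f 1) (g 0)
  *ˢ-comm f g (suc (suc n)) = begin
    f 0 * g (suc (suc n)) + (tail f *ˢ g) (suc n)
      ≈⟨ +-congˡ (*ˢ-comm (tail f) g (suc n)) ⟩
    f 0 * g (suc (suc n)) + (g 0 * f (suc (suc n)) + (tail g *ˢ tail f) n)
      ≈⟨ +-congˡ (+-congˡ (*ˢ-comm (tail g) (tail f) n)) ⟩
    f 0 * g (suc (suc n)) + (g 0 * f (suc (suc n)) + (tail f *ˢ tail g) n)
      ≈⟨ solve 3 (λ a b c → a :+ (b :+ c) := b :+ (a :+ c)) refl _ _ _ ⟩
    g 0 * f (suc (suc n)) + (f *ˢ tail g) (suc n)
      ≈⟨ +-congˡ (*ˢ-comm f (tail g) (suc n)) ⟩
    g 0 * f (suc (suc n)) + (tail g *ˢ f) (suc n) ∎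

  constant-*ˢ : ∀ a f n → (constant a *ˢ f) n ≈ a * f n
  constant-*ˢ a f zero    = +-identityʳ _
  constant-*ˢ a f (suc n) =
    trans (+-congˡ (*ˢ-vanishˡ (tail (constant a)) f n λ _ _ → refl)) (+-identityʳ _)

  *ˢ-identityˡ : ∀ f → (1ˢ *ˢ f) ≈ˢ f
  *ˢ-identityˡ f n = trans (constant-*ˢ 1# f n) (*-identityˡ _)

  seriesRing : CommutativeRing c ℓ
  seriesRing = record
    { Carrier = Series
    ; _≈_ = _≈ˢ_
    ; _+_ = _+ˢ_
    ; _*_ = _*ˢ_
    ; -_ = -ˢ_
    ; 0# = 0ˢ
    ; 1# = 1ˢ
    ; isCommutativeRing = record
      { isRing = record
        { +-isAbelianGroup = record
          { isGroup = record
            { isMonoid = record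
              { isSemigroup = record
                { isMagma = record
                  { isEquivalence = record
                    { refl  = λ n → refl
                    ; sym   = λ p n → sym (p n)
                    ; trans = λ p q n → trans (p n) (q n)
                    }
                  ; ∙-cong = λ p q n → +-cong (p n) (q n)
                  }
                ; assoc = λ f g h n → +-assoc _ _ _
                }
              ; identity =
                  (λ f n → trans (+-congʳ (constant-0 n)) (+-identityˡ _))
                , (λ f n → trans (+-congˡ (constant-0 n)) (+-identityʳ _))
              }
            ; inverse =
                (λ f n → trans (-‿inverseˡ _) (sym (constant-0 n)))
              , (λ f n → trans (-‿inverseʳ _) (sym (constant-0 n)))
            ; ⁻¹-cong = λ p n → -‿cong (p n)
            }
          ; comm = λ f g n → +-comm _ _
          }
        ; *-cong = λ {f} {f′} {g} {g′} → *ˢ-cong f f′ g g′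
        ; *-assoc = *ˢ-assoc
        ; *-identity = *ˢ-identityˡ , (λ f n → trans (*ˢ-comm f 1ˢ n) (*ˢ-identityˡ f n))
        ; distrib = (λ h f g n → trans (*ˢ-comm h (f +ˢ g) n) (trans (*ˢ-distribʳ h f g n)
                       (+-cong (*ˢ-comm f h n) (*ˢ-comm g h n))))
                  , *ˢ-distribʳ
        }
      ; *-comm = *ˢ-comm
      }
    }

  module S = CommutativeRing seriesRing
  module S× = SemiringMult S.semiring

  ×ˢ-pointwise : ∀ m f n → (m S×.× f) n ≈ m × f n
  ×ˢ-pointwise zero    f n = constant-0 n
  ×ˢ-pointwise (suc m) f n = +-congˡ (×ˢ-pointwise m f n)

  ×-zeroʳ : ∀ n → n × 0# ≈ 0#
  ×-zeroʳ zero    = refl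
  ×-zeroʳ (suc n) = trans (+-identityˡ _) (×-zeroʳ n)

  -- The derivation f ↦ t f′ interacts with the recursion for products more
  -- simply than f ↦ f′ does.
  θ : Series → Series
  θ f n = n × f n

  ∂ : Series → Series
  ∂ f n = suc n × f (suc n)

  -- The induction closes because `tail (θ f)` is `tail f +ˢ θ (tail f)` by computation, while the
  -- constant term of `θ f` is zero.
  θ-leibniz : ∀ f g → θ (f *ˢ g) ≈ˢ ((θ f *ˢ g) +ˢ (f *ˢ θ g))
  θ-leibniz f g zero    = solve 2 (λ a b → con 0 := con 0 :* b :+ con 0 :+ (a :* con 0 :+ con 0)) refl (f 0) (g 0)
  θ-leibniz f g (suc n) = begin
    P + n × P
      ≈⟨ +-congˡ (×-distrib-+ (f 0 * g (suc n)) ((tail f *ˢ g) n) n) ⟩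
    P + (n × (f 0 * g (suc n)) + n × (tail f *ˢ g) n)
      ≈⟨ +-congˡ (+-cong (sym (×-comm-* n _ _)) (θ-leibniz (tail f) g n)) ⟩
    P + (f 0 * (n × g (suc n)) + ((θ (tail f) *ˢ g) n + (tail f *ˢ θ g) n))
      ≈⟨ solve 6 (λ a b b′ x y z →
           (a :* b :+ x) :+ (a :* b′ :+ (y :+ z)) := con 0 :* b :+ (x :+ y) :+ (a :* (b :+ b′) :+ z))
           refl (f 0) (g (suc n)) (n × g (suc n)) ((tail f *ˢ g) n) ((θ (tail f) *ˢ g) n) ((tail f *ˢ θ g) n) ⟩
    0# * g (suc n) + ((tail f *ˢ g) n + (θ (tail f) *ˢ g) n) + (f 0 * θ g (suc n) + (tail f *ˢ θ g) n)
      ≈⟨ +-congʳ (+-congˡ (sym (*ˢ-distribʳ g (tail f) (θ (tail f)) n))) ⟩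
    0# * g (suc n) + ((tail f +ˢ θ (tail f)) *ˢ g) n + (f 0 * θ g (suc n) + (tail f *ˢ θ g) n) ∎
    where P = f 0 * g (suc n) + (tail f *ˢ g) n

  tail-*ˢ : ∀ {f} g → f 0 ≈ 0# → tail (f *ˢ g) ≈ˢ (tail f *ˢ g)
  tail-*ˢ g f₀≈0 n = trans (+-congʳ (trans (*-congʳ f₀≈0) (zeroˡ _))) (+-identityˡ _)

  -- By definition `∂ f` is `tail (θ f)`, so this is `θ-leibniz` one degree higher: `θ` of a series
  -- has no constant term, hence `tail` passes onto that factor.
  ∂-leibniz : ∀ f g → ∂ (f *ˢ g) ≈ˢ ((∂ f *ˢ g) +ˢ (f *ˢ ∂ g))
  ∂-leibniz f g n = begin
    ∂ (f *ˢ g) n                                  ≈⟨ θ-leibniz f g (suc n) ⟩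
    (θ f *ˢ g) (suc n) + (f *ˢ θ g) (suc n)       ≈⟨ +-congˡ (*ˢ-comm f (θ g) (suc n)) ⟩
    (θ f *ˢ g) (suc n) + (θ g *ˢ f) (suc n)       ≈⟨ +-cong (tail-*ˢ {θ f} g refl n) (tail-*ˢ {θ g} f refl n) ⟩
    (∂ f *ˢ g) n + (∂ g *ˢ f) n                   ≈⟨ +-congˡ (*ˢ-comm (∂ g) f n) ⟩
    (∂ f *ˢ g) n + (f *ˢ ∂ g) n ∎

  ∂-cong : ∀ f g → f ≈ˢ g → ∂ f ≈ˢ ∂ g
  ∂-cong f g f≈g n = ×-congʳ (suc n) (f≈g (suc n))

  ∂-+ : ∀ f g → ∂ (f +ˢ g) ≈ˢ (∂ f +ˢ ∂ g)
  ∂-+ f g n = ×-distrib-+ (f (suc n)) (g (suc n)) (suc n)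

  ∂-isDerivation : IsDerivation seriesRing ∂
  ∂-isDerivation = record { ∂-cong = ∂-cong ; ∂-* = ∂-leibniz }

module _ {c ℓ} (A : CommutativeRing c ℓ) where
  open CommutativeRing A
  open GroupProperties +-group using () renaming (∙-cancelʳ to +-cancelʳ)
  open ≈-Reasoning setoid

  -- The geometric series y = Σ (1 - x)ᵐ enters only through its fixed-point equation; adding (1 -
  -- x) y to x y gives y on one side and the unfolded y on the other.
  reciprocal-unfold : ∀ {x y} → y ≈ 1# + (1# + - x) * y → x * y ≈ 1#
  reciprocal-unfold {x} {y} y-eq = +-cancelʳ ((1# + - x) * y) (x * y) 1# (begin
    x * y + (1# + - x) * y ≈⟨ distribʳ y x (1# + - x) ⟨
    (x + (1# + - x)) * y   ≈⟨ *-congʳ (trans (+-congˡ (+-comm 1# (- x))) (trans (sym (+-assoc x (- x) 1#))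
                                (trans (+-congʳ (-‿inverseʳ x)) (+-identityˡ 1#)))) ⟩
    1# * y                 ≈⟨ *-identityˡ y ⟩
    y                      ≈⟨ y-eq ⟩
    1# + (1# + - x) * y    ∎)

-- Consequences of the Leibniz rule in an arbitrary commutative ring.

module Derivation {c ℓ} {A : CommutativeRing c ℓ} {∂ : CommutativeRing.Carrier A → CommutativeRing.Carrier A}
                  (isDerivation : IsDerivation A ∂) where
  open CommutativeRing A
  open IsDerivation isDerivation
  open SemiringMult semiring using (_×_; ×-congʳ; ×-assoc-*; ×-comm-*)
  open GroupProperties +-group using (identityˡ-unique)
  open RingProperties ring using (-‿distribˡ-*; -‿+-comm)
  open RawSemiringDefs (RawRing.rawSemiring rawRing) using (_^_)
  open SemiringSolver commutativeSemiring using (solve; _:+_; _:*_; _:=_; con)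
  open ≈-Reasoning setoid

  ∂-1 : ∂ 1# ≈ 0#
  ∂-1 = identityˡ-unique (∂ 1#) (∂ 1#) (begin
    ∂ 1# + ∂ 1#           ≈⟨ solve 1 (λ x → x :+ x := x :* con 1 :+ con 1 :* x) refl (∂ 1#) ⟩
    ∂ 1# * 1# + 1# * ∂ 1# ≈⟨ ∂-* 1# 1# ⟨
    ∂ (1# * 1#)           ≈⟨ ∂-cong _ _ (*-identityˡ 1#) ⟩
    ∂ 1#                  ∎)

  mutual
    ∂-^ : ∀ x m → ∂ (x ^ suc m) ≈ suc m × (x ^ m * ∂ x)
    ∂-^ x m = begin
      ∂ (x * x ^ m)                     ≈⟨ ∂-* x (x ^ m) ⟩
      ∂ x * x ^ m + x * ∂ (x ^ m)       ≈⟨ +-cong (*-comm _ _) (x*∂-^ x m) ⟩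
      x ^ m * ∂ x + m × (x ^ m * ∂ x)   ∎

    -- The extra factor `x` avoids the exponent m - 1, so that m = 0 is covered and the power rule
    -- can recurse through it.
    x*∂-^ : ∀ x m → x * ∂ (x ^ m) ≈ m × (x ^ m * ∂ x)
    x*∂-^ x zero    = trans (*-congˡ ∂-1) (zeroʳ x)
    x*∂-^ x (suc m) = begin
      x * ∂ (x ^ suc m)                 ≈⟨ *-congˡ (∂-^ x m) ⟩
      x * (suc m × (x ^ m * ∂ x))       ≈⟨ ×-comm-* (suc m) x (x ^ m * ∂ x) ⟩
      suc m × (x * (x ^ m * ∂ x))       ≈⟨ ×-congʳ (suc m) (sym (*-assoc x (x ^ m) (∂ x))) ⟩
      suc m × (x ^ suc m * ∂ x)         ∎

  fromInteger : ℤ → Carrier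
  fromInteger (+ n)    = n × 1#
  fromInteger -[1+ n ] = - (suc n × 1#)

  -- The inverse is a separate argument, so that the clauses match those of `_^ˢ_` once `recip` is
  -- supplied for it.
  zpow : Carrier → Carrier → ℤ → Carrier
  zpow x x⁻¹ (+ n)    = x ^ n
  zpow x x⁻¹ -[1+ n ] = x⁻¹ ^ suc n

  ×≈×1* : ∀ n x → n × x ≈ n × 1# * x
  ×≈×1* n x = trans (×-congʳ n (sym (*-identityˡ x))) (sym (×-assoc-* n 1# x))

  module _ {b v e} (b*v≈1 : b * v ≈ 1#) (∂v : ∂ v + e ≈ v) where

    -- In the application v = (eᵗ-1)/t and e = e₂. Inserting `b * v ≈ 1#` into both summands, and v
    -- = ∂v + e into the second, leaves b ∂(b v) = b ∂1 = 0 beside the term with e.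
    ∂-reciprocal : ∂ b + b ≈ e * (b * b)
    ∂-reciprocal = begin
      ∂ b + b
        ≈⟨ solve 2 (λ b b′ → b′ :+ b := b′ :* con 1 :+ b :* con 1) refl b (∂ b) ⟩
      ∂ b * 1# + b * 1#
        ≈⟨ +-cong (*-congˡ (sym b*v≈1)) (*-congˡ (trans (sym b*v≈1) (*-congˡ (sym ∂v)))) ⟩
      ∂ b * (b * v) + b * (b * (∂ v + e))
        ≈⟨ solve 5 (λ b b′ v v′ e →
             b′ :* (b :* v) :+ b :* (b :* (v′ :+ e)) := b :* (b′ :* v :+ b :* v′) :+ e :* (b :* b))
             refl b (∂ b) v (∂ v) e ⟩
      b * (∂ b * v + b * ∂ v) + e * (b * b)
        ≈⟨ +-congʳ (trans (*-congˡ (begin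
             ∂ b * v + b * ∂ v ≈⟨ ∂-* b v ⟨
             ∂ (b * v)         ≈⟨ ∂-cong _ _ b*v≈1 ⟩
             ∂ 1#              ≈⟨ ∂-1 ⟩
             0#                ∎)) (zeroʳ b)) ⟩
      0# + e * (b * b)
        ≈⟨ +-identityˡ _ ⟩
      e * (b * b) ∎

    ∂-zpow : ∀ r → ∂ (zpow b v r) + fromInteger r * zpow b v r
                   ≈ fromInteger r * (e * zpow b v (r ℤ.+ 1ℤ))
    ∂-zpow (+ zero)  = begin
      ∂ 1# + 0# * 1#     ≈⟨ +-cong ∂-1 (zeroˡ 1#) ⟩
      0# + 0#            ≈⟨ +-identityˡ 0# ⟩
      0#                 ≈⟨ zeroˡ _ ⟨
      0# * (e * b ^ 1)   ∎
    ∂-zpow (+ suc m) = begin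
      ∂ (b ^ suc m) + M * (b * b ^ m)
        ≈⟨ +-congʳ (trans (∂-^ b m) (×≈×1* (suc m) _)) ⟩
      M * (b ^ m * ∂ b) + M * (b * b ^ m)
        ≈⟨ solve 4 (λ M b b′ c → M :* (c :* b′) :+ M :* (b :* c) := M :* (c :* (b′ :+ b)))
             refl M b (∂ b) (b ^ m) ⟩
      M * (b ^ m * (∂ b + b))
        ≈⟨ *-congˡ (*-congˡ ∂-reciprocal) ⟩
      M * (b ^ m * (e * (b * b)))
        ≈⟨ solve 4 (λ M b e c → M :* (c :* (e :* (b :* b))) := M :* (e :* (b :* (b :* c))))
             refl M b e (b ^ m) ⟩
      M * (e * b ^ (2 ℕ.+ m))
        -- Integer addition puts the 1 on the right: r + 1 computes to `suc m ℕ.+ 1`.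
        ≡⟨ ≡.cong (λ k → M * (e * b ^ suc k)) (ℕ.+-comm 1 m) ⟩
      M * (e * b ^ (suc m ℕ.+ 1)) ∎
      where M = suc m × 1#
    -- A negative power of b is a power of v, so the linear equation of v is substituted directly:
    -- the v part cancels and the e part keeps one factor v fewer.
    ∂-zpow -[1+ m ]  = begin
      ∂ (v ^ suc m) + - M * (v * v ^ m)
        ≈⟨ +-cong (trans (∂-^ v m) (×≈×1* (suc m) _)) (sym (-‿distribˡ-* _ _)) ⟩
      M * (v ^ m * ∂ v) + - (M * (v * v ^ m))
        ≈⟨ +-congˡ (-‿cong (*-congˡ (*-congʳ (sym ∂v)))) ⟩
      M * (v ^ m * ∂ v) + - (M * ((∂ v + e) * v ^ m))
        ≈⟨ +-congˡ (-‿cong (solve 4 (λ M v′ e c →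
             M :* ((v′ :+ e) :* c) := M :* (c :* v′) :+ M :* (e :* c)) refl M (∂ v) e (v ^ m))) ⟩
      M * (v ^ m * ∂ v) + - (M * (v ^ m * ∂ v) + M * (e * v ^ m))
        ≈⟨ +-congˡ (sym (-‿+-comm _ _)) ⟩
      M * (v ^ m * ∂ v) + (- (M * (v ^ m * ∂ v)) + - (M * (e * v ^ m)))
        ≈⟨ trans (sym (+-assoc _ _ _)) (trans (+-congʳ (-‿inverseʳ _)) (+-identityˡ _)) ⟩
      - (M * (e * v ^ m))
        ≈⟨ -‿distribˡ-* _ _ ⟩
      - M * (e * v ^ m)
        ≡⟨ ≡.cong (λ z → - M * (e * z)) (zpow-1+ m) ⟩
      - M * (e * zpow b v (-[1+ m ] ℤ.+ 1ℤ)) ∎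
      where
      M = suc m × 1#
      -- At m = 0 the exponent r + 1 reaches zero and `zpow` passes from powers of v to `b ^ 0`;
      -- both are `1#`.
      zpow-1+ : ∀ m → v ^ m ≡ zpow b v (-[1+ m ] ℤ.+ 1ℤ)
      zpow-1+ zero    = ≡.refl
      zpow-1+ (suc m) = ≡.refl

    -- Here p is the poly-Bernoulli series and w = e⁻ᵗ. The factor w is attached to the power of b
    -- rather than to g, because bʳ e⁻ᵗ is what later generates the Bernoulli polynomials at x - 1.
    ∂-zpow-* : ∀ r {p w g} → ∂ p ≈ w * g →
               ∂ (zpow b v r * p) + fromInteger r * (zpow b v r * p)
                 ≈ fromInteger r * (e * (zpow b v (r ℤ.+ 1ℤ) * p)) + g * (zpow b v r * w)
    ∂-zpow-* r {p} {w} {g} ∂p = begin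
      ∂ (z * p) + ρ * (z * p)
        ≈⟨ +-congʳ (trans (∂-* z p) (+-congˡ (*-congˡ ∂p))) ⟩
      ∂ z * p + z * (w * g) + ρ * (z * p)
        ≈⟨ solve 6 (λ ρ z z′ p w g →
             z′ :* p :+ z :* (w :* g) :+ ρ :* (z :* p) := (z′ :+ ρ :* z) :* p :+ g :* (z :* w))
             refl ρ z (∂ z) p w g ⟩
      (∂ z + ρ * z) * p + g * (z * w)
        ≈⟨ +-congʳ (*-congʳ (∂-zpow r)) ⟩
      ρ * (e * z₊) * p + g * (z * w)
        ≈⟨ +-congʳ (solve 4 (λ ρ e z p → ρ :* (e :* z) :* p := ρ :* (e :* (z :* p))) refl ρ e z₊ p) ⟩
      ρ * (e * (z₊ * p)) + g * (z * w) ∎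
      where
      ρ = fromInteger r
      z = zpow b v r
      z₊ = zpow b v (r ℤ.+ 1ℤ)

  ∂-*-linear : ∀ {f g a b} → ∂ f ≈ a * f → ∂ g ≈ b * g → ∂ (f * g) ≈ b * (f * g) + a * (f * g)
  ∂-*-linear {f} {g} {a} {b} ∂f ∂g = begin
    ∂ (f * g)                  ≈⟨ ∂-* f g ⟩
    ∂ f * g + f * ∂ g          ≈⟨ +-cong (*-congʳ ∂f) (*-congˡ ∂g) ⟩
    a * f * g + f * (b * g)    ≈⟨ solve 4 (λ f g a b → a :* f :* g :+ f :* (b :* g) := b :* (f :* g) :+ a :* (f :* g)) refl f g a b ⟩
    b * (f * g) + a * (f * g)  ∎

  ∂-*-exponential : ∀ {f ρ e f₊ g h E x} →
                    ∂ f + ρ * f ≈ ρ * (e * f₊) + g * h → ∂ E ≈ x * E →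
                    ∂ (f * E) + ρ * (f * E) ≈ ρ * (e * (f₊ * E)) + g * (h * E) + x * (f * E)
  ∂-*-exponential {f} {ρ} {e} {f₊} {g} {h} {E} {x} ∂f ∂E = begin
    ∂ (f * E) + ρ * (f * E)
      ≈⟨ +-congʳ (trans (∂-* f E) (+-congˡ (*-congˡ ∂E))) ⟩
    ∂ f * E + f * (x * E) + ρ * (f * E)
      ≈⟨ solve 5 (λ f f′ E x ρ →
           f′ :* E :+ f :* (x :* E) :+ ρ :* (f :* E) := (f′ :+ ρ :* f) :* E :+ x :* (f :* E))
           refl f (∂ f) E x ρ ⟩
    (∂ f + ρ * f) * E + x * (f * E)
      ≈⟨ +-congʳ (*-congʳ ∂f) ⟩
    (ρ * (e * f₊) + g * h) * E + x * (f * E)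
      ≈⟨ solve 8 (λ f ρ e f₊ g h E x →
           (ρ :* (e :* f₊) :+ g :* h) :* E :+ x :* (f :* E)
             := ρ :* (e :* (f₊ :* E)) :+ g :* (h :* E) :+ x :* (f :* E))
           refl f ρ e f₊ g h E x ⟩
    ρ * (e * (f₊ * E)) + g * (h * E) + x * (f * E) ∎

-- Composition of series: chain rule, reciprocals and quotients.

module Composition {c ℓ} (R : CommutativeRing c ℓ) where
  open CommutativeRing R
  open SemiringMult semiring using (_×_; ×-congʳ; ×-assoc-*; ×-comm-*)
  open Sums rawRing
  open SumProperties R
  open PowerSeries rawRing
  open RawRing powerSeriesRing using ()
    renaming (_≈_ to _≈ˢ_; _+_ to _+ˢ_; _*_ to _*ˢ_; -_ to -ˢ_; 1# to 1ˢ)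
  open RawSemiringDefs (RawRing.rawSemiring powerSeriesRing) using () renaming (_^_ to _^ⁿ_)
  open SeriesRing R
  module ∂ˢ = Derivation ∂-isDerivation
  open ≈-Reasoning setoid

  -- Unlike in `compose`, the length `N` is independent of the coefficient index, so linear facts
  -- follow by induction on `N`.
  combination : ℕ → Series → (ℕ → Series) → Series
  combination N a F n = ∑[ m < N ] (a m * F m n)

  *ˢ-combination : ∀ N g a F → (g *ˢ combination N a F) ≈ˢ combination N a (λ m → g *ˢ F m)
  *ˢ-combination zero    g a F n = trans (*ˢ-comm g (λ _ → 0#) n) (*ˢ-vanishˡ (λ _ → 0#) g n λ _ _ → refl)
  *ˢ-combination (suc N) g a F n = begin
    (g *ˢ (scale (a 0) (F 0) +ˢ rest)) n
      ≈⟨ S.distribˡ g (scale (a 0) (F 0)) rest n ⟩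
    (g *ˢ scale (a 0) (F 0)) n + (g *ˢ rest) n
      ≈⟨ +-cong (begin
           (g *ˢ scale (a 0) (F 0)) n ≈⟨ *ˢ-comm g (scale (a 0) (F 0)) n ⟩
           (scale (a 0) (F 0) *ˢ g) n ≈⟨ *ˢ-scaleˡ (a 0) (F 0) g n ⟩
           a 0 * (F 0 *ˢ g) n         ≈⟨ *-congˡ (*ˢ-comm (F 0) g n) ⟩
           a 0 * (g *ˢ F 0) n         ∎)
         (*ˢ-combination N g (tail a) (λ m → F (suc m)) n) ⟩
    a 0 * (g *ˢ F 0) n + combination N (tail a) (λ m → g *ˢ F (suc m)) n ∎
    where rest = combination N (tail a) (λ m → F (suc m))

  ∂-combination : ∀ N a F → ∂ (combination N a F) ≈ˢ combination N a (λ m → ∂ (F m))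
  ∂-combination zero    a F n = ×-zeroʳ (suc n)
  ∂-combination (suc N) a F n = trans
    (∂-+ (scale (a 0) (F 0)) (combination N (tail a) (λ m → F (suc m))) n)
    (+-cong (sym (×-comm-* (suc n) (a 0) (F 0 (suc n))))
            (∂-combination N (tail a) (λ m → F (suc m)) n))

  module _ {h : Series} (h₀≈0 : h 0 ≈ 0#) where

    ^-vanish : ∀ m n → n < m → (h ^ⁿ m) n ≈ 0#
    ^-vanish (suc m) zero    _         = trans (+-identityʳ _) (trans (*-congʳ h₀≈0) (zeroˡ _))
    ^-vanish (suc m) (suc n) (s≤s n<m) = begin
      (h *ˢ h ^ⁿ m) (suc n)   ≈⟨ tail-*ˢ {h} (h ^ⁿ m) h₀≈0 n ⟩
      (tail h *ˢ h ^ⁿ m) n    ≈⟨ *ˢ-comm (tail h) (h ^ⁿ m) n ⟩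
      (h ^ⁿ m *ˢ tail h) n    ≈⟨ *ˢ-vanishˡ (h ^ⁿ m) (tail h) n (λ i i≤n → ^-vanish m i (ℕ.≤-<-trans i≤n n<m)) ⟩
      0#                      ∎

    compose≈combination : ∀ a N n → n < N → compose a h n ≈ combination N a (h ^ⁿ_) n
    compose≈combination a N n n<N =
      sym (∑-truncate {f = λ m → a m * (h ^ⁿ m) n} n<N λ m n<m → trans (*-congˡ (^-vanish m n n<m)) (zeroʳ (a m)))

    -- The coefficients of `compose a h` that enter have index at most `n`, and hᵐ starts in degree
    -- m, so the single length `suc n` serves them all.
    *ˢ-compose : ∀ g a n → (g *ˢ compose a h) n ≈ combination (suc n) a (λ m → g *ˢ h ^ⁿ m) n
    *ˢ-compose g a n = trans
      (*ˢ-cong-≤ {g} {g} {compose a h} {combination (suc n) a (h ^ⁿ_)} n (λ _ _ → refl)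
         λ i i≤n → compose≈combination a (suc n) i (s≤s i≤n))
      (*ˢ-combination (suc n) g a (h ^ⁿ_) n)

    -- Horner's rule a(h) = a₀ + h · (`tail a`)(h). With all aₘ = 1 it is the fixed-point equation
    -- of the geometric series; with a = `Li k` it exhibits the factor y of Li_k(y).
    compose-unfold : ∀ a → compose a h ≈ˢ (constant (a 0) +ˢ (h *ˢ compose (tail a) h))
    compose-unfold a zero    = +-cong (*-identityʳ _) (sym (trans (+-identityʳ _) (trans (*-congʳ h₀≈0) (zeroˡ _))))
    compose-unfold a (suc n) = +-cong (zeroʳ _) (begin
      combination (suc n) (tail a) (λ m → tail (h *ˢ h ^ⁿ m)) n
        ≈⟨ ∑-cong (suc n) (λ m _ → *-congˡ {tail a m} (tail-*ˢ {h} (h ^ⁿ m) h₀≈0 n)) ⟩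
      combination (suc n) (tail a) (λ m → tail h *ˢ h ^ⁿ m) n
        ≈⟨ *ˢ-compose (tail h) (tail a) n ⟨
      (tail h *ˢ compose (tail a) h) n
        ≈⟨ tail-*ˢ {h} (compose (tail a) h) h₀≈0 n ⟨
      (h *ˢ compose (tail a) h) (suc n) ∎)

    ∂-compose : ∀ a → ∂ (compose a h) ≈ˢ (∂ h *ˢ compose (∂ a) h)
    ∂-compose a n = begin
      suc n × compose a h (suc n)
        -- The derivative at `n` reads coefficient n + 1, hence the length n + 2; the term m = 0 has
        -- derivative zero, which leaves the n + 1 terms of `compose (∂ a) h`.
        ≈⟨ ×-congʳ (suc n) (compose≈combination a (suc (suc n)) (suc n) ℕ.≤-refl) ⟩
      ∂ (combination (suc (suc n)) a (h ^ⁿ_)) n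
        ≈⟨ ∂-combination (suc (suc n)) a (h ^ⁿ_) n ⟩
      a 0 * ∂ 1ˢ n + combination (suc n) (tail a) (λ m → ∂ (h ^ⁿ suc m)) n
        ≈⟨ +-cong (trans (*-congˡ (trans (∂ˢ.∂-1 n) (constant-0 n))) (zeroʳ _)) (∑-cong (suc n) λ m _ → term m) ⟩
      0# + combination (suc n) (∂ a) (λ m → ∂ h *ˢ h ^ⁿ m) n
        ≈⟨ +-identityˡ _ ⟩
      combination (suc n) (∂ a) (λ m → ∂ h *ˢ h ^ⁿ m) n
        ≈⟨ *ˢ-compose (∂ h) (∂ a) n ⟨
      (∂ h *ˢ compose (∂ a) h) n ∎
      where
      term : ∀ m → a (suc m) * ∂ (h ^ⁿ suc m) n ≈ ∂ a m * (∂ h *ˢ h ^ⁿ m) n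
      term m = begin
        a (suc m) * ∂ (h ^ⁿ suc m) n
          ≈⟨ *-congˡ (trans (∂ˢ.∂-^ h m n) (×ˢ-pointwise (suc m) (h ^ⁿ m *ˢ ∂ h) n)) ⟩
        a (suc m) * (suc m × (h ^ⁿ m *ˢ ∂ h) n)
          ≈⟨ trans (×-comm-* (suc m) _ _) (sym (×-assoc-* (suc m) _ _)) ⟩
        ∂ a m * (h ^ⁿ m *ˢ ∂ h) n
          ≈⟨ *-congˡ (*ˢ-comm (h ^ⁿ m) (∂ h) n) ⟩
        ∂ a m * (∂ h *ˢ h ^ⁿ m) n ∎

  *ˢ-recip : ∀ f → f 0 ≈ 1# → (f *ˢ recip f) ≈ˢ 1ˢ
  *ˢ-recip f f₀≈1 = reciprocal-unfold seriesRing {f} {recip f}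
    (compose-unfold {1ˢ +ˢ (-ˢ f)} (trans (+-congˡ (-‿cong f₀≈1)) (-‿inverseʳ 1#)) λ _ → 1#)

  *ˢ-/ˢ : ∀ {f g} → g 0 ≈ 0# → g 1 ≈ 1# → ((g *ˢ f) /ˢ g) ≈ˢ f
  *ˢ-/ˢ {f} {g} g₀≈0 g₁≈1 n = begin
    (tail (g *ˢ f) *ˢ recip (tail g)) n   ≈⟨ *ˢ-cong (tail (g *ˢ f)) (tail g *ˢ f) (recip (tail g)) (recip (tail g)) (tail-*ˢ {g} f g₀≈0) (λ _ → refl) n ⟩
    ((tail g *ˢ f) *ˢ recip (tail g)) n   ≈⟨ swap (tail g) f (recip (tail g)) n ⟩
    (f *ˢ (tail g *ˢ recip (tail g))) n   ≈⟨ *ˢ-cong f f (tail g *ˢ recip (tail g)) 1ˢ (λ _ → refl) (*ˢ-recip (tail g) g₁≈1) n ⟩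
    (f *ˢ 1ˢ) n                           ≈⟨ S.*-identityʳ f n ⟩
    f n                                   ∎
    where
    open SemiringSolver S.commutativeSemiring using (solve; _:*_; _:=_)
    swap : ∀ f g h → ((f *ˢ g) *ˢ h) ≈ˢ (g *ˢ (f *ˢ h))
    swap = solve 3 (λ f g h → (f :* g) :* h := g :* (f :* h)) S.refl

-- Single Horner steps for substitution into polynomials, over an abstract ring.

module HornerSteps {c ℓ} (A : CommutativeRing c ℓ) where
  open CommutativeRing A
  open SemiringSolver commutativeSemiring using (solve; _:+_; _:*_; _:=_; con)

  horner-+ : ∀ a b x {u v w} → w ≈ u + v → (a + b) + x * w ≈ (a + x * u) + (b + x * v)
  horner-+ a b x {u} {v} w≈u+v = trans (+-congˡ (*-congˡ w≈u+v))
    (solve 5 (λ a b x u v → (a :+ b) :+ x :* (u :+ v) := (a :+ x :* u) :+ (b :+ x :* v)) refl a b x u v)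

  horner-· : ∀ a b x {d u w} → d ≈ a * b → w ≈ a * u → d + x * w ≈ a * (b + x * u)
  horner-· a b x {u = u} d≈a*b w≈a*u = trans (+-cong d≈a*b (*-congˡ w≈a*u))
    (solve 4 (λ a b x u → a :* b :+ x :* (a :* u) := a :* (b :+ x :* u)) refl a b x u)

  horner-* : ∀ a x {s d u v w} → s ≈ a * v → d ≈ 0# → w ≈ u * v → s + (d + x * w) ≈ (a + x * u) * v
  horner-* a x {u = u} {v = v} s≈a*v d≈0 w≈u*v = trans (+-cong s≈a*v (+-cong d≈0 (*-congˡ w≈u*v)))
    (solve 4 (λ a x u v → a :* v :+ (con 0 :+ x :* (u :* v)) := (a :+ x :* u) :* v) refl a x u v)

  horner-X : ∀ x {d} → d ≈ 0# → d + x * (1# + x * 0#) ≈ x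
  horner-X x d≈0 = trans (+-congʳ d≈0)
    (solve 1 (λ x → con 0 :+ x :* (con 1 :+ x :* con 0) := x) refl x)

-- Polynomials: the commutative ring, scalars and substitution.

module PolynomialRing {c ℓ} (R : CommutativeRing c ℓ) where
  open CommutativeRing R
  open RingProperties ring using (-0#≈0#)
  open Sums rawRing
  open PowerSeries rawRing
  open Polynomials rawRing
  open SeriesRing R
  open RawRing powerSeriesRing using ()
    renaming (_≈_ to _≈ˢ_; _+_ to _+ˢ_; _*_ to _*ˢ_; -_ to -ˢ_)
  open ≈-Reasoning setoid

  coeff-+ : ∀ p q → coeff (p +ᵖ q) ≈ˢ (coeff p +ˢ coeff q)
  coeff-+ []      q       n       = sym (+-identityˡ _)
  coeff-+ (a ∷ p) []      n       = sym (+-identityʳ _)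
  coeff-+ (a ∷ p) (b ∷ q) zero    = refl
  coeff-+ (a ∷ p) (b ∷ q) (suc n) = coeff-+ p q n

  coeff-· : ∀ a p → coeff (a · p) ≈ˢ scale a (coeff p)
  coeff-· a []      n       = sym (zeroʳ a)
  coeff-· a (b ∷ p) zero    = refl
  coeff-· a (b ∷ p) (suc n) = coeff-· a p n

  coeff-* : ∀ p q → coeff (p *ᵖ q) ≈ˢ (coeff p *ˢ coeff q)
  coeff-* []      q n       = sym (*ˢ-vanishˡ (coeff []) (coeff q) n λ _ _ → refl)
  coeff-* (a ∷ p) q zero    = trans (coeff-+ (a · q) (0# ∷ (p *ᵖ q)) 0) (+-congʳ (coeff-· a q 0))
  coeff-* (a ∷ p) q (suc n) =
    trans (coeff-+ (a · q) (0# ∷ (p *ᵖ q)) (suc n)) (+-cong (coeff-· a q (suc n)) (coeff-* p q n))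

  coeff-- : ∀ p → coeff (map -_ p) ≈ˢ (-ˢ coeff p)
  coeff-- []      n       = sym -0#≈0#
  coeff-- (a ∷ p) zero    = refl
  coeff-- (a ∷ p) (suc n) = coeff-- p n

  coeff-C : ∀ a → coeff (C a) ≈ˢ constant a
  coeff-C a zero    = refl
  coeff-C a (suc n) = refl

  -- Equality of polynomials is by definition equality of coefficient series, so injectivity is
  -- immediate and the ring laws are pulled back from power series.
  coeff-isRingMonomorphism : IsRingMonomorphism polynomialRing powerSeriesRing coeff
  coeff-isRingMonomorphism = record
    { isRingHomomorphism = record
      { isSemiringHomomorphism = record
        { isNearSemiringHomomorphism = record
          { +-isMonoidHomomorphism = record
            { isMagmaHomomorphism = record
              { isRelHomomorphism = record { cong = λ p≈q → p≈q }
              ; homo = coeff-+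
              }
            ; ε-homo = λ n → sym (constant-0 n)
            }
          ; *-homo = coeff-*
          }
        ; 1#-homo = coeff-C 1#
        }
      ; -‿homo = coeff--
      }
    ; injective = λ p≈q → p≈q
    }

  polynomialCommutativeRing : CommutativeRing c ℓ
  polynomialCommutativeRing = record
    { RawRing polynomialRing
    ; isCommutativeRing = RingMonomorphism.isCommutativeRing coeff-isRingMonomorphism S.isCommutativeRing
    }

  module P = CommutativeRing polynomialCommutativeRing

  ·≈C* : ∀ a p → (a · p) ≈ᵖ (C a *ᵖ p)
  ·≈C* a p n = begin
    coeff (a · p) n                  ≈⟨ coeff-· a p n ⟩
    a * coeff p n                    ≈⟨ constant-*ˢ a (coeff p) n ⟨
    (constant a *ˢ coeff p) n        ≈⟨ *ˢ-cong (coeff (C a)) (constant a) (coeff p) (coeff p) (coeff-C a) (λ _ → refl) n ⟨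
    (coeff (C a) *ˢ coeff p) n       ≈⟨ coeff-* (C a) p n ⟨
    coeff (C a *ᵖ p) n               ∎

  C-cong : ∀ {a b} → a ≈ b → C a ≈ᵖ C b
  C-cong a≈b zero    = a≈b
  C-cong a≈b (suc n) = refl

  C-0 : C 0# ≈ᵖ []
  C-0 zero    = refl
  C-0 (suc n) = refl

  C-* : ∀ a b → C (a * b) ≈ᵖ (C a *ᵖ C b)
  C-* a b = ·≈C* a (C b)

  ·-cong : ∀ {a b p q} → a ≈ b → p ≈ᵖ q → (a · p) ≈ᵖ (b · q)
  ·-cong {a} {b} {p} {q} a≈b p≈q n =
    trans (coeff-· a p n) (trans (*-cong a≈b (p≈q n)) (sym (coeff-· b q n)))

  module _ (q : Polynomial) where
    open HornerSteps polynomialCommutativeRing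

    ⟨⟩-+ : ∀ p p′ → ((p +ᵖ p′) ⟨ q ⟩) ≈ᵖ (p ⟨ q ⟩ +ᵖ p′ ⟨ q ⟩)
    ⟨⟩-+ []      p′       = P.refl {p′ ⟨ q ⟩}
    ⟨⟩-+ (a ∷ p) []       = P.sym {(a ∷ p) ⟨ q ⟩ +ᵖ []} {(a ∷ p) ⟨ q ⟩} (P.+-identityʳ ((a ∷ p) ⟨ q ⟩))
    ⟨⟩-+ (a ∷ p) (b ∷ p′) =
      horner-+ (C a) (C b) q {p ⟨ q ⟩} {p′ ⟨ q ⟩} {(p +ᵖ p′) ⟨ q ⟩} (⟨⟩-+ p p′)

    ⟨⟩-·-C* : ∀ a p → ((a · p) ⟨ q ⟩) ≈ᵖ (C a *ᵖ p ⟨ q ⟩)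
    ⟨⟩-·-C* a []      = P.sym {C a *ᵖ []} {[]} (P.zeroʳ (C a))
    ⟨⟩-·-C* a (b ∷ p) =
      horner-· (C a) (C b) q {C (a * b)} {p ⟨ q ⟩} {(a · p) ⟨ q ⟩} (C-* a b) (⟨⟩-·-C* a p)

    ⟨⟩-· : ∀ a p → ((a · p) ⟨ q ⟩) ≈ᵖ (a · p ⟨ q ⟩)
    ⟨⟩-· a p n = trans (⟨⟩-·-C* a p n) (sym (·≈C* a (p ⟨ q ⟩) n))

    ⟨⟩-* : ∀ p p′ → ((p *ᵖ p′) ⟨ q ⟩) ≈ᵖ (p ⟨ q ⟩ *ᵖ p′ ⟨ q ⟩)
    ⟨⟩-* []      p′ = P.refl {[]}
    ⟨⟩-* (a ∷ p) p′ = P.trans {((a · p′) +ᵖ (0# ∷ (p *ᵖ p′))) ⟨ q ⟩}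
      {(a · p′) ⟨ q ⟩ +ᵖ (C 0# +ᵖ q *ᵖ (p *ᵖ p′) ⟨ q ⟩)} {(a ∷ p) ⟨ q ⟩ *ᵖ p′ ⟨ q ⟩}
      (⟨⟩-+ (a · p′) (0# ∷ (p *ᵖ p′)))
      (horner-* (C a) q {(a · p′) ⟨ q ⟩} {C 0#} {p ⟨ q ⟩} {p′ ⟨ q ⟩} {(p *ᵖ p′) ⟨ q ⟩}
        (⟨⟩-·-C* a p′) C-0 (⟨⟩-* p p′))

    ⟨⟩-C : ∀ a → (C a ⟨ q ⟩) ≈ᵖ C a
    ⟨⟩-C a = P.trans {C a +ᵖ q *ᵖ []} {C a +ᵖ []} {C a}
      (P.+-congˡ {C a} {q *ᵖ []} {[]} (P.zeroʳ q)) (P.+-identityʳ (C a))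

    ⟨⟩-X : (X ⟨ q ⟩) ≈ᵖ q
    ⟨⟩-X = horner-X q {C 0#} C-0

module InverseUniqueness {c ℓ} (A : CommutativeRing c ℓ) where
  open CommutativeRing A
  open ≈-Reasoning setoid

  inverse-unique : ∀ {x y z} → x * y ≈ 1# → x * z ≈ 1# → y ≈ z
  inverse-unique {x} {y} {z} x*y≈1 x*z≈1 = begin
    y            ≈⟨ *-identityʳ y ⟨
    y * 1#       ≈⟨ *-congˡ x*z≈1 ⟨
    y * (x * z)  ≈⟨ *-assoc y x z ⟨
    y * x * z    ≈⟨ *-congʳ (trans (*-comm y x) x*y≈1) ⟩
    1# * z       ≈⟨ *-identityˡ z ⟩
    z            ∎

heytingRing : ∀ {c ℓ₁ ℓ₂} → HeytingField c ℓ₁ ℓ₂ → CommutativeRing c ℓ₁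
heytingRing K = HeytingCommutativeRing.commutativeRing (HeytingField.heytingCommutativeRing K)

-- Reciprocals of positive integers in characteristic zero.

module Reciprocals {c ℓ₁ ℓ₂} (K : HeytingField c ℓ₁ ℓ₂) (char0 : CharacteristicZero K) where
  open MixedType K char0 using (fromℕ; 1/_)
  open CommutativeRing (heytingRing K)
  open InverseUniqueness (heytingRing K)
  open HeytingField K using (#⇒invertible)
  open RingProperties ring using (-0#≈0#)
  open SemiringMult semiring using (_×_; ×-congʳ; ×-assoc-*; ×1-homo-*)
  open SemiringSolver commutativeSemiring using (solve; _:*_; _:=_)
  open ≈-Reasoning setoid

  fromℕ-* : ∀ m n → fromℕ (m ℕ.* n) ≈ fromℕ m * fromℕ n
  fromℕ-* = ×1-homo-*

  fromℕ-*-× : ∀ n x → fromℕ n * x ≈ n × x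
  fromℕ-*-× n x = trans (×-assoc-* n 1# x) (×-congʳ n (*-identityˡ x))

  fromℕ-1 : fromℕ 1 ≈ 1#
  fromℕ-1 = +-identityʳ 1#

  fromℕ-inverse : ∀ n .{{_ : NonZero n}} → fromℕ n * 1/ n ≈ 1#
  fromℕ-inverse (suc n) = begin
    fromℕ (suc n) * 1/ suc n              ≈⟨ *-congʳ (trans (+-congˡ -0#≈0#) (+-identityʳ _)) ⟨
    -- Apartness from `0#` provides an inverse of the difference with `0#`, not of the number
    -- itself.
    (fromℕ (suc n) + - 0#) * 1/ suc n     ≈⟨ proj₂ (proj₂ (#⇒invertible (char0 n))) ⟩
    1#                                    ∎

  -- Since `1/ n` is a witness extracted from apartness, identities between reciprocals are reached
  -- through uniqueness of inverses.
  1/-unique : ∀ n .{{_ : NonZero n}} {x} → fromℕ n * x ≈ 1# → x ≈ 1/ n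
  1/-unique n n*x≈1 = inverse-unique n*x≈1 (fromℕ-inverse n)

  1/-1 : 1/ 1 ≈ 1#
  1/-1 = sym (1/-unique 1 (trans (*-identityʳ _) fromℕ-1))

  fromℕ-*-1/ : ∀ m n .{{_ : NonZero m}} .{{_ : NonZero n}} → fromℕ m * 1/ (m ℕ.* n) ≈ 1/ n
  fromℕ-*-1/ m n = 1/-unique n (begin
    fromℕ n * (fromℕ m * 1/ (m ℕ.* n))
      ≈⟨ solve 3 (λ a b x → b :* (a :* x) := (a :* b) :* x) refl (fromℕ m) (fromℕ n) (1/ (m ℕ.* n)) ⟩
    fromℕ m * fromℕ n * 1/ (m ℕ.* n)
      ≈⟨ *-congʳ (fromℕ-* m n) ⟨
    fromℕ (m ℕ.* n) * 1/ (m ℕ.* n)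
      ≈⟨ fromℕ-inverse (m ℕ.* n) {{m*n≢0 m n}} ⟩
    1# ∎)

  suc-×-1/! : ∀ n → suc n × (1/ (suc n !)) ≈ 1/ (n !)
  suc-×-1/! n = trans (sym (fromℕ-*-× (suc n) _)) (fromℕ-*-1/ (suc n) (n !) {{_}} {{n !≢0}})

  ×-cancel : ∀ n {x y} → suc n × x ≈ suc n × y → x ≈ y
  ×-cancel n {x} {y} eq = begin
    x                                ≈⟨ split x ⟨
    1/ suc n * (suc n × x)           ≈⟨ *-congˡ eq ⟩
    1/ suc n * (suc n × y)           ≈⟨ split y ⟩
    y                                ∎
    where
    split : ∀ z → 1/ suc n * (suc n × z) ≈ z
    split z = begin
      1/ suc n * (suc n × z)          ≈⟨ *-congˡ (fromℕ-*-× (suc n) z) ⟨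
      1/ suc n * (fromℕ (suc n) * z)  ≈⟨ *-assoc _ _ _ ⟨
      1/ suc n * fromℕ (suc n) * z    ≈⟨ *-congʳ (trans (*-comm _ _) (fromℕ-inverse (suc n))) ⟩
      1# * z                          ≈⟨ *-identityˡ z ⟩
      z                               ∎

-- The Bernoulli and poly-Bernoulli series over K, and Stirling numbers.

module ScalarSeries {c ℓ₁ ℓ₂} (K : HeytingField c ℓ₁ ℓ₂) (char0 : CharacteristicZero K) where
  open MixedType K char0 using
    ( fromℕ; fromℤ; 1/_; _^ᶻ_; _^_; ∑-below
    ; t; exp; Li; bernoulliSeries; polyBernoulliSeries; module K⟦t⟧ )
  open CommutativeRing (heytingRing K)
  open RawSemiringDefs (RawRing.rawSemiring K⟦t⟧.powerSeriesRing) using ()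
    renaming (_^_ to _^ⁿ_)
  open Reciprocals K char0
  open SumProperties (heytingRing K)
  open SeriesRing (heytingRing K)
  open Composition (heytingRing K)
  open K⟦t⟧
  open RawRing powerSeriesRing using () renaming (_≈_ to _≈ˢ_)
  open RingProperties ring using (-0#≈0#; -1*x≈-x; -‿involutive)
  open GroupProperties +-group using () renaming (∙-cancelʳ to +-cancelʳ)
  open SemiringMult semiring using (_×_; ×-congʳ; ×-assoc-*; ×-comm-*; ×-homo-+)
  open SemiringSolver commutativeSemiring using (solve; _:+_; _:*_; _:=_; con)
  open ≈-Reasoning setoid

  1^n≈1 : ∀ n → 1# ^ n ≈ 1#
  1^n≈1 zero    = refl
  1^n≈1 (suc n) = trans (*-identityˡ _) (1^n≈1 n)

  ∂-exp : ∀ a n → ∂ (exp a) n ≈ a * exp a n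
  ∂-exp a n = begin
    suc n × (1/ (suc n !) * a ^ suc n)    ≈⟨ ×-assoc-* (suc n) _ _ ⟨
    suc n × (1/ (suc n !)) * (a * a ^ n)  ≈⟨ *-congʳ (suc-×-1/! n) ⟩
    1/ (n !) * (a * a ^ n)                ≈⟨ solve 3 (λ x y z → x :* (y :* z) := y :* (x :* z)) refl (1/ (n !)) a (a ^ n) ⟩
    a * exp a n                           ∎

  exp-0 : ∀ a → exp a 0 ≈ 1#
  exp-0 a = trans (*-identityʳ _) 1/-1

  -- (eᵗ − 1) / t and (eᵗ − 1 − t) / t²
  expQuotient₁ expQuotient₂ : Series
  expQuotient₁ n = 1/ (suc n !)
  expQuotient₂ n = 1/ (suc (suc n) !)

  denominator : Series
  denominator = tail (exp 1# +ˢ -ˢ 1ˢ)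

  denominator≈ : denominator ≈ˢ expQuotient₁
  denominator≈ n = trans (+-congˡ -0#≈0#) (trans (+-identityʳ _) (trans (*-congˡ (1^n≈1 (suc n))) (*-identityʳ _)))

  denominator-0 : denominator 0 ≈ 1#
  denominator-0 = trans (denominator≈ 0) 1/-1

  -- At index n the left side consists of (n+1) + 1 copies of 1/(n+2)!, which is 1/(n+1)!.
  ∂-expQuotient₁ : (∂ expQuotient₁ +ˢ expQuotient₂) ≈ˢ expQuotient₁
  ∂-expQuotient₁ n = trans (+-comm _ _) (suc-×-1/! (suc n))

  b b⁻¹ : Series
  b   = bernoulliSeries
  b⁻¹ = recip b

  b≈recip : b ≈ˢ recip denominator
  b≈recip n = trans (*ˢ-cong (tail t) 1ˢ (recip denominator) (recip denominator) tail-t (λ _ → refl) n)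
                    (S.*-identityˡ (recip denominator) n)
    where
    tail-t : tail t ≈ˢ 1ˢ
    tail-t zero    = refl
    tail-t (suc n) = refl

  b*denominator≈1 : (b *ˢ denominator) ≈ˢ 1ˢ
  b*denominator≈1 n = begin
    (b *ˢ denominator) n                  ≈⟨ *ˢ-comm b denominator n ⟩
    (denominator *ˢ b) n                  ≈⟨ *ˢ-cong denominator denominator b (recip denominator) (λ _ → refl) b≈recip n ⟩
    (denominator *ˢ recip denominator) n  ≈⟨ *ˢ-recip denominator denominator-0 n ⟩
    1ˢ n                                  ∎

  b*b⁻¹≈1 : (b *ˢ b⁻¹) ≈ˢ 1ˢ
  b*b⁻¹≈1 = *ˢ-recip b (trans (b≈recip 0) (trans (+-identityʳ _) (*-identityˡ _)))

  -- As series `recip b` is a reciprocal of a reciprocal; it is identified with `denominator`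
  -- because both are inverse to b.
  b⁻¹≈expQuotient₁ : b⁻¹ ≈ˢ expQuotient₁
  b⁻¹≈expQuotient₁ n = trans
    (InverseUniqueness.inverse-unique seriesRing {b} {b⁻¹} {denominator} b*b⁻¹≈1 b*denominator≈1 n)
    (denominator≈ n)

  ∂-b⁻¹ : (∂ b⁻¹ +ˢ expQuotient₂) ≈ˢ b⁻¹
  ∂-b⁻¹ n = begin
    ∂ b⁻¹ n + expQuotient₂ n            ≈⟨ +-congʳ (∂-cong b⁻¹ expQuotient₁ b⁻¹≈expQuotient₁ n) ⟩
    ∂ expQuotient₁ n + expQuotient₂ n   ≈⟨ ∂-expQuotient₁ n ⟩
    expQuotient₁ n                      ≈⟨ b⁻¹≈expQuotient₁ n ⟨
    b⁻¹ n                               ∎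

  y : Series
  y = 1ˢ +ˢ -ˢ exp (- 1#)

  y₀≈0 : y 0 ≈ 0#
  y₀≈0 = trans (+-congˡ (-‿cong (exp-0 (- 1#)))) (-‿inverseʳ 1#)

  ∂-y : ∂ y ≈ˢ exp (- 1#)
  ∂-y n = begin
    suc n × (0# + - E)        ≈⟨ ×-congʳ (suc n) (trans (+-identityˡ _) (sym (-1*x≈-x E))) ⟩
    suc n × (- 1# * E)        ≈⟨ ×-comm-* (suc n) (- 1#) E ⟨
    - 1# * ∂ (exp (- 1#)) n   ≈⟨ *-congˡ (∂-exp (- 1#) n) ⟩
    - 1# * (- 1# * exp (- 1#) n)  ≈⟨ trans (-1*x≈-x _) (trans (-‿cong (-1*x≈-x _)) (-‿involutive _)) ⟩
    exp (- 1#) n              ∎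
    where E = exp (- 1#) (suc n)

  y₁≈1 : y 1 ≈ 1#
  y₁≈1 = trans (sym (+-identityʳ _)) (trans (∂-y 0) (exp-0 (- 1#)))

  -- Li_k has no constant term, so Li_k(y) = y Q with Q = Σ yᵐ/(m+1)ᵏ, and y = t + O(t²) makes the
  -- quotient by y cancel.
  polyBernoulli≈compose : ∀ k → polyBernoulliSeries k ≈ˢ compose (tail (Li k)) y
  polyBernoulli≈compose k n = trans
    (*ˢ-cong (tail (compose (Li k) y)) (tail (y *ˢ Q)) (recip (tail y)) (recip (tail y))
      (λ m → trans (compose-unfold y₀≈0 (Li k) (suc m)) (+-identityˡ _)) (λ _ → refl) n)
    (*ˢ-/ˢ {Q} {y} y₀≈0 y₁≈1 n)
    where Q = compose (tail (Li k)) y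

  -- Σₘ (m+1) yᵐ / (m+2)ᵏ
  derivedSeries : ℤ → Series
  derivedSeries k = compose (∂ (tail (Li k))) y

  ∂-polyBernoulli : ∀ k → ∂ (polyBernoulliSeries k) ≈ˢ (exp (- 1#) *ˢ derivedSeries k)
  ∂-polyBernoulli k n = begin
    ∂ (polyBernoulliSeries k) n
      ≈⟨ ∂-cong (polyBernoulliSeries k) (compose (tail (Li k)) y) (polyBernoulli≈compose k) n ⟩
    ∂ (compose (tail (Li k)) y) n
      ≈⟨ ∂-compose y₀≈0 (tail (Li k)) n ⟩
    (∂ y *ˢ derivedSeries k) n
      ≈⟨ *ˢ-cong (∂ y) (exp (- 1#)) (derivedSeries k) (derivedSeries k) ∂-y (λ _ → refl) n ⟩
    (exp (- 1#) *ˢ derivedSeries k) n ∎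

  zpow≡^ˢ : ∀ r → ∂ˢ.zpow b b⁻¹ r ≡ b ^ˢ r
  zpow≡^ˢ (+ n)    = ≡.refl
  zpow≡^ˢ -[1+ n ] = ≡.refl

  ×-1ˢ : ∀ n → (n S×.× 1ˢ) ≈ˢ constant (fromℕ n)
  ×-1ˢ n zero    = ×ˢ-pointwise n 1ˢ 0
  ×-1ˢ n (suc m) = trans (×ˢ-pointwise n 1ˢ (suc m)) (×-zeroʳ n)

  fromInteger≈constant : ∀ r → ∂ˢ.fromInteger r ≈ˢ constant (fromℤ r)
  fromInteger≈constant (+ n)    m       = ×-1ˢ n m
  fromInteger≈constant -[1+ n ] zero    = -‿cong (×-1ˢ (suc n) 0)
  fromInteger≈constant -[1+ n ] (suc m) = trans (-‿cong (×-1ˢ (suc n) (suc m))) -0#≈0#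

  fromInteger-* : ∀ r f n → (∂ˢ.fromInteger r *ˢ f) n ≈ fromℤ r * f n
  fromInteger-* r f n = trans
    (*ˢ-cong (∂ˢ.fromInteger r) (constant (fromℤ r)) f f (fromInteger≈constant r) (λ _ → refl) n)
    (constant-*ˢ (fromℤ r) f n)

  mixed : ℤ → ℤ → Series
  mixed r k = (b ^ˢ r) *ˢ polyBernoulliSeries k

  private
    -- For a variable r, `zpow` and `_^ˢ_` agree only propositionally. With `z` and `z₊`
    -- generalised, matching on the two equalities exchanges every occurrence at once.
    ∂-zpow-polyBernoulli : ∀ r k z z₊ → ∂ˢ.zpow b b⁻¹ r ≡ z → ∂ˢ.zpow b b⁻¹ (r ℤ.+ 1ℤ) ≡ z₊ →
      (∂ (z *ˢ polyBernoulliSeries k) +ˢ (∂ˢ.fromInteger r *ˢ (z *ˢ polyBernoulliSeries k)))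
        ≈ˢ ((∂ˢ.fromInteger r *ˢ (expQuotient₂ *ˢ (z₊ *ˢ polyBernoulliSeries k)))
            +ˢ (derivedSeries k *ˢ (z *ˢ exp (- 1#))))
    ∂-zpow-polyBernoulli r k _ _ ≡.refl ≡.refl =
      ∂ˢ.∂-zpow-* {b} {b⁻¹} {expQuotient₂} b*b⁻¹≈1 ∂-b⁻¹ r
        {polyBernoulliSeries k} {exp (- 1#)} {derivedSeries k} (∂-polyBernoulli k)

  ∂-mixed : ∀ r k n → ∂ (mixed r k) n + fromℤ r * mixed r k n
                      ≈ fromℤ r * (expQuotient₂ *ˢ mixed (r ℤ.+ 1ℤ) k) n
                        + (derivedSeries k *ˢ ((b ^ˢ r) *ˢ exp (- 1#))) n
  ∂-mixed r k n = trans
    (+-congˡ (sym (fromInteger-* r (mixed r k) n)))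
    (trans (∂-zpow-polyBernoulli r k (b ^ˢ r) (b ^ˢ (r ℤ.+ 1ℤ)) (zpow≡^ˢ r) (zpow≡^ˢ (r ℤ.+ 1ℤ)) n)
           (+-congʳ (fromInteger-* r (expQuotient₂ *ˢ mixed (r ℤ.+ 1ℤ) k) n)))

  -1*-1≈1 : - 1# * - 1# ≈ 1#
  -1*-1≈1 = trans (-1*x≈-x (- 1#)) (-‿involutive 1#)

  private
    -- The algebra of the inductive step of `!-*-y^`, with q for -1, M = m+1, W = n!, f = m!, x =
    -- S₂(n,m), x′ = S₂(n,m+1), and σ, τ the signs (-1)ⁿ, (-1)ᵐ. Of -1 only q² = 1 and 1 + q = 0 are
    -- retained, so it can be a variable of a semiring identity; q B is added to both sides and the
    -- zero (1 + q) B is inserted to balance it.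
    signed-step : ∀ q M W x x′ z σ τ f → q * q ≈ 1# → 1# + q ≈ 0# →
                  W * z + σ * (q * τ * (M * f * x′)) ≈ σ * (τ * (f * x)) →
                  M * (W * z) ≈ q * σ * (q * τ * (M * f * (M * x′ + x)))
    signed-step q M W x x′ z σ τ f q²≈1 1+q≈0 eq = +-cancelʳ (q * B) (M * (W * z)) A (begin
      M * (W * z) + q * B
        ≈⟨ solve 8 (λ q M v x′ σ τ f x → M :* v :+ q :* (σ :* τ :* M :* M :* f :* x′)
             := M :* (v :+ σ :* (q :* τ :* (M :* f :* x′)))) refl q M (W * z) x′ σ τ f x ⟩
      M * (W * z + σ * (q * τ * (M * f * x′)))
        ≈⟨ *-congˡ eq ⟩
      M * (σ * (τ * (f * x)))
        ≈⟨ solve 5 (λ M x σ τ f → M :* (σ :* (τ :* (f :* x))) := con 1 :* (σ :* τ :* M :* f :* x) :+ con 0) refl M x σ τ f ⟩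
      1# * D + 0#
        ≈⟨ +-congˡ (trans (*-congʳ 1+q≈0) (zeroˡ B)) ⟨
      1# * D + (1# + q) * B
        ≈⟨ +-congˡ (*-congʳ (+-congʳ q²≈1)) ⟨
      1# * D + (q * q + q) * B
        ≈⟨ +-congʳ (*-congʳ q²≈1) ⟨
      q * q * D + (q * q + q) * B
        ≈⟨ solve 7 (λ q M x x′ σ τ f →
             q :* q :* (σ :* τ :* M :* f :* x) :+ (q :* q :+ q) :* (σ :* τ :* M :* M :* f :* x′)
             := q :* σ :* (q :* τ :* (M :* f :* (M :* x′ :+ x))) :+ q :* (σ :* τ :* M :* M :* f :* x′))
             refl q M x x′ σ τ f ⟩
      A + q * B ∎)
      where
      A = q * σ * (q * τ * (M * f * (M * x′ + x)))
      B = σ * τ * M * M * f * x′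
      D = σ * τ * M * f * x

  -- (1 − e⁻ᵗ)ᵐ = (−1)ᵐ m! Σₙ S₂(n,m) (−t)ⁿ / n!.  The recurrence for S₂ comes from
  -- differentiating: with y = 1 − e⁻ᵗ, (yᵐ⁺¹)′ = (m+1)(yᵐ − yᵐ⁺¹).
  !-*-y^ : ∀ n m → fromℕ (n !) * (y ^ⁿ m) n ≈ (- 1#) ^ n * ((- 1#) ^ m * (fromℕ (m !) * fromℕ (S₂ n m)))
  !-*-y^ zero    zero    = trans (*-identityʳ _) (trans fromℕ-1 (sym (begin
    1# * (1# * (fromℕ 1 * fromℕ 1)) ≈⟨ solve 2 (λ x y → con 1 :* (con 1 :* (x :* y)) := x :* y) refl (fromℕ 1) (fromℕ 1) ⟩
    fromℕ 1 * fromℕ 1               ≈⟨ *-cong fromℕ-1 fromℕ-1 ⟩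
    1# * 1#                         ≈⟨ *-identityˡ 1# ⟩
    1#                              ∎)))
  !-*-y^ zero    (suc m) = trans (trans (*-congˡ (^-vanish {y} y₀≈0 (suc m) 0 (s≤s z≤n))) (zeroʳ _))
    (sym (solve 3 (λ a b c → a :* (b :* (c :* con 0)) := con 0) refl 1# ((- 1#) ^ suc m) (fromℕ (suc m !))))
  !-*-y^ (suc n) zero    = trans (zeroʳ _)
    (sym (solve 3 (λ a b c → a :* (b :* (c :* con 0)) := con 0) refl ((- 1#) ^ suc n) 1# (fromℕ 1)))
  !-*-y^ (suc n) (suc m) = begin
    fromℕ (suc n !) * (y ^ⁿ suc m) (suc n)
      ≈⟨ *-congʳ (trans (fromℕ-* (suc n) (n !)) (*-comm _ _)) ⟩
    fromℕ (n !) * fromℕ (suc n) * (y ^ⁿ suc m) (suc n)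
      ≈⟨ trans (*-assoc _ _ _) (*-congˡ (fromℕ-*-× (suc n) _)) ⟩
    fromℕ (n !) * ∂ (y ^ⁿ suc m) n
      ≈⟨ *-congˡ (trans (∂ˢ.∂-^ y m n) (trans (×ˢ-pointwise (suc m) (y ^ⁿ m *ˢ ∂ y) n) (sym (fromℕ-*-× (suc m) z)))) ⟩
    fromℕ (n !) * (fromℕ (suc m) * z)
      ≈⟨ solve 3 (λ a b c → a :* (b :* c) := b :* (a :* c)) refl (fromℕ (n !)) (fromℕ (suc m)) z ⟩
    fromℕ (suc m) * (fromℕ (n !) * z)
      ≈⟨ signed-step (- 1#) (fromℕ (suc m)) (fromℕ (n !)) (fromℕ (S₂ n m)) (fromℕ (S₂ n (suc m))) z
           ((- 1#) ^ n) ((- 1#) ^ m) (fromℕ (m !)) -1*-1≈1 (-‿inverseʳ 1#) (begin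
             fromℕ (n !) * z + (- 1#) ^ n * ((- 1#) ^ suc m * (fromℕ (suc m) * fromℕ (m !) * fromℕ (S₂ n (suc m))))
               ≈⟨ +-congˡ (*-congˡ (*-congˡ (*-congʳ (fromℕ-* (suc m) (m !))))) ⟨
             fromℕ (n !) * z + (- 1#) ^ n * ((- 1#) ^ suc m * (fromℕ (suc m !) * fromℕ (S₂ n (suc m))))
               ≈⟨ +-congˡ (!-*-y^ n (suc m)) ⟨
             fromℕ (n !) * z + fromℕ (n !) * (y ^ⁿ suc m) n
               ≈⟨ trans (sym (distribˡ _ _ _)) (*-congˡ z+y^≈y^) ⟩
             fromℕ (n !) * (y ^ⁿ m) n
               ≈⟨ !-*-y^ n m ⟩
             (- 1#) ^ n * ((- 1#) ^ m * (fromℕ (m !) * fromℕ (S₂ n m))) ∎) ⟩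
    (- 1#) ^ suc n * ((- 1#) ^ suc m * (fromℕ (suc m) * fromℕ (m !) * (fromℕ (suc m) * fromℕ (S₂ n (suc m)) + fromℕ (S₂ n m))))
      ≈⟨ *-congˡ (*-congˡ (*-cong (fromℕ-* (suc m) (m !))
           (trans (×-homo-+ 1# (suc m ℕ.* S₂ n (suc m)) (S₂ n m)) (+-congʳ (fromℕ-* (suc m) (S₂ n (suc m))))))) ⟨
    (- 1#) ^ suc n * ((- 1#) ^ suc m * (fromℕ (suc m !) * fromℕ (S₂ (suc n) (suc m)))) ∎
    where
    z = (y ^ⁿ m *ˢ ∂ y) n
    z+y^≈y^ : z + (y ^ⁿ suc m) n ≈ (y ^ⁿ m) n
    z+y^≈y^ = begin
      (y ^ⁿ m *ˢ ∂ y) n + (y *ˢ y ^ⁿ m) n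
        ≈⟨ +-congˡ (*ˢ-comm y (y ^ⁿ m) n) ⟩
      (y ^ⁿ m *ˢ ∂ y) n + (y ^ⁿ m *ˢ y) n
        ≈⟨ S.distribˡ (y ^ⁿ m) (∂ y) y n ⟨
      (y ^ⁿ m *ˢ (∂ y +ˢ y)) n
        ≈⟨ *ˢ-cong (y ^ⁿ m) (y ^ⁿ m) (∂ y +ˢ y) 1ˢ (λ _ → refl) ∂y+y≈1 n ⟩
      (y ^ⁿ m *ˢ 1ˢ) n
        ≈⟨ S.*-identityʳ (y ^ⁿ m) n ⟩
      (y ^ⁿ m) n ∎
      where
      ∂y+y≈1 : (∂ y +ˢ y) ≈ˢ 1ˢ
      ∂y+y≈1 i = begin
        ∂ y i + (1ˢ i + - exp (- 1#) i)
          ≈⟨ +-cong (∂-y i) (+-comm _ _) ⟩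
        exp (- 1#) i + (- exp (- 1#) i + 1ˢ i)
          ≈⟨ trans (sym (+-assoc _ _ _)) (trans (+-congʳ (-‿inverseʳ _)) (+-identityˡ _)) ⟩
        1ˢ i ∎

  -- The coefficient of yᵐ is (m+1)/(m+2)ᵏ; its numerator joins the m! of `!-*-y^` to make (m+1)!,
  -- and (-1)ⁿ leaves the sum.
  !-*-derivedSeries : ∀ k n → fromℕ (n !) * derivedSeries k n
    ≈ (- 1#) ^ n * ∑-below (suc n) λ m →
        (- 1#) ^ m * (fromℕ (suc m !) * (suc (suc m) ^ᶻ (ℤ.- k))) * fromℕ (S₂ n m)
  !-*-derivedSeries k n = begin
    fromℕ (n !) * ∑-below (suc n) (λ m → a m * (y ^ⁿ m) n)
      ≈⟨ *-distribˡ-∑ (suc n) (fromℕ (n !)) (λ m → a m * (y ^ⁿ m) n) ⟩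
    ∑-below (suc n) (λ m → fromℕ (n !) * (a m * (y ^ⁿ m) n))
      ≈⟨ ∑-cong (suc n) {λ m → fromℕ (n !) * (a m * (y ^ⁿ m) n)} {λ m → (- 1#) ^ n * summand m} (λ m _ → term m) ⟩
    ∑-below (suc n) (λ m → (- 1#) ^ n * summand m)
      ≈⟨ *-distribˡ-∑ (suc n) ((- 1#) ^ n) summand ⟨
    (- 1#) ^ n * ∑-below (suc n) summand ∎
    where
    a : Series
    a = ∂ (tail (Li k))
    summand : ℕ → Carrier
    summand m = (- 1#) ^ m * (fromℕ (suc m !) * (suc (suc m) ^ᶻ (ℤ.- k))) * fromℕ (S₂ n m)
    term : ∀ m → fromℕ (n !) * (a m * (y ^ⁿ m) n) ≈ (- 1#) ^ n * summand m
    term m = begin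
      fromℕ (n !) * (a m * (y ^ⁿ m) n)
        ≈⟨ solve 3 (λ x y z → x :* (y :* z) := y :* (x :* z)) refl (fromℕ (n !)) (a m) ((y ^ⁿ m) n) ⟩
      a m * (fromℕ (n !) * (y ^ⁿ m) n)
        ≈⟨ *-cong (sym (fromℕ-*-× (suc m) ℓ)) (!-*-y^ n m) ⟩
      fromℕ (suc m) * ℓ * ((- 1#) ^ n * ((- 1#) ^ m * (fromℕ (m !) * fromℕ (S₂ n m))))
        ≈⟨ solve 6 (λ M l σ τ f s → M :* l :* (σ :* (τ :* (f :* s))) := σ :* (τ :* (M :* f :* l) :* s)) refl
             (fromℕ (suc m)) ℓ ((- 1#) ^ n) ((- 1#) ^ m) (fromℕ (m !)) (fromℕ (S₂ n m)) ⟩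
      (- 1#) ^ n * ((- 1#) ^ m * (fromℕ (suc m) * fromℕ (m !) * ℓ) * fromℕ (S₂ n m))
        ≈⟨ *-congˡ (*-congʳ (*-congˡ (*-congʳ (fromℕ-* (suc m) (m !))))) ⟨
      (- 1#) ^ n * summand m ∎
      where ℓ = suc (suc m) ^ᶻ (ℤ.- k)

-- Factorial identities and the rearrangement into a recurrence.

n!≡nCk*k!*[n∸k]! : ∀ {n k} → k ≤ n → n ! ≡ binom n k ℕ.* (k ! ℕ.* (n ∸ k) !)
n!≡nCk*k!*[n∸k]! {n} {k} k≤n = ≡.sym (≡.trans
  (≡.cong (ℕ._* (k ! ℕ.* (n ∸ k) !)) (nCk≡n!/k![n-k]! k≤n))
  (m/n*n≡m {{k !* (n ∸ k) !≢0}} (k![n∸k]!∣n! k≤n)))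

[n+2]!≡n!*[n+2]*[n+1] : ∀ n → suc (suc n) ! ≡ n ! ℕ.* (suc (suc n) ℕ.* suc n)
[n+2]!≡n!*[n+2]*[n+1] n = ≡.trans (≡.sym (ℕ.*-assoc (suc (suc n)) (suc n) (n !))) (ℕ.*-comm _ (n !))

module _ {c ℓ} (A : CommutativeRing c ℓ) where
  open CommutativeRing A
  open RingProperties ring using (-‿distribˡ-*)
  open SemiringSolver commutativeSemiring using (solve; _:+_; _:*_; _:=_)
  open ≈-Reasoning setoid

  -- The term ρ f of the subtraction-free equation is brought to the right by inserting 0 = -ρ m f +
  -- ρ m f. In use, m is the constant polynomial n!.
  scale-equation : ∀ m ρ x d f u v → d + ρ * f ≈ ρ * u + v + x * f →
                   m * d ≈ - ρ * (m * f) + ρ * (m * u) + m * v + x * (m * f)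
  scale-equation m ρ x d f u v eq = begin
    m * d
      ≈⟨ trans (+-congʳ (trans (+-congʳ (sym (-‿distribˡ-* ρ (m * f)))) (-‿inverseˡ _))) (+-identityˡ _) ⟨
    (- ρ * (m * f) + ρ * (m * f)) + m * d
      ≈⟨ solve 5 (λ a ρ m f d → (a :+ ρ :* (m :* f)) :+ m :* d := a :+ m :* (d :+ ρ :* f)) refl
           (- ρ * (m * f)) ρ m f d ⟩
    - ρ * (m * f) + m * (d + ρ * f)
      ≈⟨ +-congˡ (*-congˡ eq) ⟩
    - ρ * (m * f) + m * (ρ * u + v + x * f)
      ≈⟨ solve 7 (λ a ρ m f u v x → a :+ m :* (ρ :* u :+ v :+ x :* f)
           := a :+ ρ :* (m :* u) :+ m :* v :+ x :* (m :* f)) refl (- ρ * (m * f)) ρ m f u v x ⟩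
    - ρ * (m * f) + ρ * (m * u) + m * v + x * (m * f) ∎

-- Series over K[x]: transfer, the shift to x - 1, and coefficient extraction.

module PolynomialSeries {c ℓ₁ ℓ₂} (K : HeytingField c ℓ₁ ℓ₂) (char0 : CharacteristicZero K) where
  open MixedType K char0 using
    ( fromℕ; fromℤ; 1/_; _^ᶻ_; _^_; ∑-below; ∑ᵖ-below
    ; Polynomial; _≈ᵖ_; _+ᵖ_; _*ᵖ_; _·_; C; X; coeff; _⟨_⟩
    ; module K⟦t⟧; module K[x]⟦t⟧; exp; exp-xt; embed; bernoulliSeries; egfCoeff; s; 𝔹 )
  open CommutativeRing (heytingRing K) using
    ( Carrier; _≈_; _+_; _*_; -_; 1#; refl; sym; trans
    ; +-congˡ; *-congˡ; *-congʳ; *-assoc; *-comm; semiring; commutativeSemiring )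
  open RawRing K⟦t⟧.powerSeriesRing using () renaming (_*_ to _*ˢ_)
  open RawRing K[x]⟦t⟧.powerSeriesRing using ()
    renaming (_≈_ to _≈ᵗ_; _+_ to _+ᵗ_; _*_ to _*ᵗ_)
  open RawSemiringDefs (RawRing.rawSemiring (Polynomials.polynomialRing (fieldRing K))) using ()
    renaming (_^_ to _^ᵖ_)
  open K⟦t⟧ using (_^ˢ_)
  open Reciprocals K char0
  open ScalarSeries K char0
  open PolynomialRing (heytingRing K)
  module K⟦t⟧ᵣ = SeriesRing (heytingRing K)
  module T = SeriesRing polynomialCommutativeRing
  module ∂ᵗ = Derivation T.∂-isDerivation
  module ∑ᵖ = SumProperties polynomialCommutativeRing
  open SemiringMult semiring using (_×_; ×-congʳ; ×-assoc-*)
  open SemiringMult P.semiring using () renaming (_×_ to _×ᵖ_)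
  open CommutativeSemigroupProperties P.*-commutativeSemigroup using (x∙yz≈y∙xz)
  open SemiringSolver commutativeSemiring using (solve; _:*_; _:=_)
  open ≈-Reasoning P.setoid

  C-∑ : ∀ n f → C (∑-below n f) ≈ᵖ ∑ᵖ-below n (λ i → C (f i))
  C-∑ zero    f = C-0
  C-∑ (suc n) f = P.+-congˡ {C (f 0)} {C (∑-below n λ i → f (suc i))} {∑ᵖ-below n λ i → C (f (suc i))}
                    (C-∑ n λ i → f (suc i))

  C-× : ∀ n a → C (n × a) ≈ᵖ n ×ᵖ C a
  C-× zero    a = C-0
  C-× (suc n) a = P.+-congˡ {C a} {C (n × a)} {n ×ᵖ C a} (C-× n a)

  coeff-× : ∀ n p m → coeff (n ×ᵖ p) m ≈ n × coeff p m
  coeff-× zero    p m = refl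
  coeff-× (suc n) p m = trans (coeff-+ p (n ×ᵖ p) m) (+-congˡ (coeff-× n p m))

  embed-* : ∀ f g → embed (f *ˢ g) ≈ᵗ (embed f *ᵗ embed g)
  embed-* f g n = P.trans {C ((f *ˢ g) n)} {∑ᵖ-below (suc n) (λ i → C (f i * g (n ∸ i)))} {(embed f *ᵗ embed g) n}
    (C-∑ (suc n) λ i → f i * g (n ∸ i))
    (∑ᵖ.∑-cong (suc n) {λ i → C (f i * g (n ∸ i))} {λ i → C (f i) *ᵖ C (g (n ∸ i))} λ i _ → C-* (f i) (g (n ∸ i)))

  constant-C-*ᵗ : ∀ a f n → C (a * f n) ≈ᵖ (K[x]⟦t⟧.constant (C a) *ᵗ embed f) n
  constant-C-*ᵗ a f n = begin
    C (a * f n)                                  ≈⟨ C-* a (f n) ⟩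
    C a *ᵖ C (f n)                               ≈⟨ T.constant-*ˢ (C a) (embed f) n ⟨
    (K[x]⟦t⟧.constant (C a) *ᵗ embed f) n        ∎

  ∂-embed : ∀ f → T.∂ (embed f) ≈ᵗ embed (K⟦t⟧ᵣ.∂ f)
  ∂-embed f n = P.sym {C (K⟦t⟧ᵣ.∂ f n)} {T.∂ (embed f) n} (C-× (suc n) (f (suc n)))

  module _ (r k : ℤ) where
    private
      ρ φf φe φf₊ φg φh : K[x]⟦t⟧.Series
      ρ   = K[x]⟦t⟧.constant (C (fromℤ r))
      φf  = embed (mixed r k)
      φe  = embed expQuotient₂
      φf₊ = embed (mixed (r ℤ.+ 1ℤ) k)
      φg  = embed (derivedSeries k)
      φh  = embed ((bernoulliSeries ^ˢ r) *ˢ exp (- 1#))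

    ∂-embed-mixed : (T.∂ φf +ᵗ (ρ *ᵗ φf)) ≈ᵗ ((ρ *ᵗ (φe *ᵗ φf₊)) +ᵗ (φg *ᵗ φh))
    ∂-embed-mixed n = begin
      T.∂ φf n +ᵖ (ρ *ᵗ φf) n
        ≈⟨ P.+-cong {T.∂ φf n} {C (K⟦t⟧ᵣ.∂ (mixed r k) n)} {(ρ *ᵗ φf) n} {C (fromℤ r * mixed r k n)}
             (∂-embed (mixed r k) n)
             (P.sym {C (fromℤ r * mixed r k n)} {(ρ *ᵗ φf) n} (constant-C-*ᵗ (fromℤ r) (mixed r k) n)) ⟩
      C (K⟦t⟧ᵣ.∂ (mixed r k) n + fromℤ r * mixed r k n)
        ≈⟨ C-cong (∂-mixed r k n) ⟩
      C (fromℤ r * u n) +ᵖ C (v n)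
        ≈⟨ P.+-cong {C (fromℤ r * u n)} {(ρ *ᵗ embed u) n} {C (v n)} {(φg *ᵗ φh) n}
             (constant-C-*ᵗ (fromℤ r) u n)
             (embed-* (derivedSeries k) ((bernoulliSeries ^ˢ r) *ˢ exp (- 1#)) n) ⟩
      (ρ *ᵗ embed u) n +ᵖ (φg *ᵗ φh) n
        ≈⟨ P.+-congʳ {(φg *ᵗ φh) n} {(ρ *ᵗ embed u) n} {(ρ *ᵗ (φe *ᵗ φf₊)) n}
             (T.*ˢ-cong ρ ρ (embed u) (φe *ᵗ φf₊) (λ m → P.refl {ρ m})
               (embed-* expQuotient₂ (mixed (r ℤ.+ 1ℤ) k)) n) ⟩
      (ρ *ᵗ (φe *ᵗ φf₊)) n +ᵖ (φg *ᵗ φh) n ∎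
      where
      u = expQuotient₂ *ˢ mixed (r ℤ.+ 1ℤ) k
      v = derivedSeries k *ˢ ((bernoulliSeries ^ˢ r) *ˢ exp (- 1#))

  -- This is e^{qt}. The case q = X is `exp-xt` by definition; the case q = X - 1 serves the shift.
  expPower : Polynomial → K[x]⟦t⟧.Series
  expPower q n = (1/ (n !)) · (q ^ᵖ n)

  ×-· : ∀ n a p → (n ×ᵖ (a · p)) ≈ᵖ ((n × a) · p)
  ×-· n a p m = trans (coeff-× n (a · p) m) (trans (×-congʳ n (coeff-· a p m))
    (trans (sym (×-assoc-* n a (coeff p m))) (sym (coeff-· (n × a) p m))))

  ·-*ᵖ : ∀ a p q → (a · (p *ᵖ q)) ≈ᵖ (p *ᵖ (a · q))
  ·-*ᵖ a p q = begin
    a · (p *ᵖ q)       ≈⟨ ·≈C* a (p *ᵖ q) ⟩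
    C a *ᵖ (p *ᵖ q)    ≈⟨ x∙yz≈y∙xz (C a) p q ⟩
    p *ᵖ (C a *ᵖ q)    ≈⟨ P.*-congˡ {p} {a · q} {C a *ᵖ q} (·≈C* a q) ⟨
    p *ᵖ (a · q)       ∎

  ∂-expPower : ∀ q n → T.∂ (expPower q) n ≈ᵖ (q *ᵖ expPower q n)
  ∂-expPower q n = begin
    suc n ×ᵖ ((1/ (suc n !)) · (q *ᵖ q ^ᵖ n))  ≈⟨ ×-· (suc n) (1/ (suc n !)) (q *ᵖ q ^ᵖ n) ⟩
    (suc n × (1/ (suc n !))) · (q *ᵖ q ^ᵖ n)   ≈⟨ ·-cong {p = q *ᵖ q ^ᵖ n} {q *ᵖ q ^ᵖ n} (suc-×-1/! n) (P.refl {q *ᵖ q ^ᵖ n}) ⟩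
    (1/ (n !)) · (q *ᵖ q ^ᵖ n)                 ≈⟨ ·-*ᵖ (1/ (n !)) q (q ^ᵖ n) ⟩
    q *ᵖ expPower q n                          ∎

  -- The equation says (n+1) Fₙ₊₁ = q Fₙ, and characteristic zero permits cancelling n + 1.
  linear-ode-unique : ∀ q F G → F 0 ≈ᵖ G 0 → (∀ n → T.∂ F n ≈ᵖ (q *ᵖ F n)) → (∀ n → T.∂ G n ≈ᵖ (q *ᵖ G n)) → F ≈ᵗ G
  linear-ode-unique q F G F₀≈G₀ ∂F ∂G zero      = F₀≈G₀
  linear-ode-unique q F G F₀≈G₀ ∂F ∂G (suc n) m = ×-cancel n
    (trans (sym (coeff-× (suc n) (F (suc n)) m)) (trans (step m) (coeff-× (suc n) (G (suc n)) m)))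
    where
    step : T.∂ F n ≈ᵖ T.∂ G n
    step = begin
      T.∂ F n      ≈⟨ ∂F n ⟩
      q *ᵖ F n     ≈⟨ P.*-congˡ {q} {F n} {G n} (linear-ode-unique q F G F₀≈G₀ ∂F ∂G n) ⟩
      q *ᵖ G n     ≈⟨ ∂G n ⟨
      T.∂ G n      ∎

  X-1 : Polynomial
  X-1 = X +ᵖ C (- 1#)

  ∂-exp-xt : T.∂ exp-xt ≈ᵗ (K[x]⟦t⟧.constant X *ᵗ exp-xt)
  ∂-exp-xt n = begin
    T.∂ exp-xt n                        ≈⟨ ∂-expPower X n ⟩
    X *ᵖ exp-xt n                       ≈⟨ T.constant-*ˢ X exp-xt n ⟨
    (K[x]⟦t⟧.constant X *ᵗ exp-xt) n    ∎

  -- Both sides solve F′ = (X - 1) F with initial value 1, which replaces a binomial expansion of (X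
  -- - 1)ⁿ.
  expPower-X-1 : expPower X-1 ≈ᵗ (embed (exp (- 1#)) *ᵗ exp-xt)
  expPower-X-1 = linear-ode-unique X-1 (expPower X-1) (φ *ᵗ exp-xt) base (∂-expPower X-1) step
    where
    φ = embed (exp (- 1#))
    c₋₁ = K[x]⟦t⟧.constant (C (- 1#))
    cX = K[x]⟦t⟧.constant X
    base : expPower X-1 0 ≈ᵖ ((C (exp (- 1#) 0) *ᵖ exp-xt 0) +ᵖ [])
    base = begin
      -- A zeroth power is 1 for every base, so `expPower X-1 0` and `exp-xt 0` are the same by
      -- computation.
      exp-xt 0                                 ≈⟨ P.*-identityˡ (exp-xt 0) ⟨
      C 1# *ᵖ exp-xt 0                         ≈⟨ P.*-congʳ {exp-xt 0} {C (exp (- 1#) 0)} {C 1#} (C-cong (exp-0 (- 1#))) ⟨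
      C (exp (- 1#) 0) *ᵖ exp-xt 0             ≈⟨ P.+-identityʳ (C (exp (- 1#) 0) *ᵖ exp-xt 0) ⟨
      (C (exp (- 1#) 0) *ᵖ exp-xt 0) +ᵖ []     ∎
    ∂φ : T.∂ φ ≈ᵗ (c₋₁ *ᵗ φ)
    ∂φ n = begin
      T.∂ φ n                              ≈⟨ ∂-embed (exp (- 1#)) n ⟩
      C (K⟦t⟧ᵣ.∂ (exp (- 1#)) n)           ≈⟨ C-cong (∂-exp (- 1#) n) ⟩
      C (- 1# * exp (- 1#) n)              ≈⟨ constant-C-*ᵗ (- 1#) (exp (- 1#)) n ⟩
      (c₋₁ *ᵗ φ) n                         ∎
    step : ∀ n → T.∂ (φ *ᵗ exp-xt) n ≈ᵖ (X-1 *ᵖ (φ *ᵗ exp-xt) n)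
    step n = begin
      T.∂ (φ *ᵗ exp-xt) n
        ≈⟨ ∂ᵗ.∂-*-linear {φ} {exp-xt} {c₋₁} {cX} ∂φ ∂-exp-xt n ⟩
      (cX *ᵗ (φ *ᵗ exp-xt)) n +ᵖ (c₋₁ *ᵗ (φ *ᵗ exp-xt)) n
        ≈⟨ P.+-cong {(cX *ᵗ (φ *ᵗ exp-xt)) n} {X *ᵖ (φ *ᵗ exp-xt) n} {(c₋₁ *ᵗ (φ *ᵗ exp-xt)) n} {C (- 1#) *ᵖ (φ *ᵗ exp-xt) n}
             (T.constant-*ˢ X (φ *ᵗ exp-xt) n) (T.constant-*ˢ (C (- 1#)) (φ *ᵗ exp-xt) n) ⟩
      (X *ᵖ (φ *ᵗ exp-xt) n) +ᵖ (C (- 1#) *ᵖ (φ *ᵗ exp-xt) n)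
        ≈⟨ P.distribʳ ((φ *ᵗ exp-xt) n) X (C (- 1#)) ⟨
      X-1 *ᵖ (φ *ᵗ exp-xt) n ∎

  module _ (q : Polynomial) where
    ⟨⟩-^ : ∀ n → ((X ^ᵖ n) ⟨ q ⟩) ≈ᵖ (q ^ᵖ n)
    ⟨⟩-^ zero    = ⟨⟩-C q 1#
    ⟨⟩-^ (suc n) = begin
      (X *ᵖ X ^ᵖ n) ⟨ q ⟩             ≈⟨ ⟨⟩-* q X (X ^ᵖ n) ⟩
      X ⟨ q ⟩ *ᵖ (X ^ᵖ n) ⟨ q ⟩       ≈⟨ P.*-cong {X ⟨ q ⟩} {q} {(X ^ᵖ n) ⟨ q ⟩} {q ^ᵖ n} (⟨⟩-X q) (⟨⟩-^ n) ⟩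
      q *ᵖ q ^ᵖ n                     ∎

    exp-xt-⟨⟩ : ∀ n → (exp-xt n ⟨ q ⟩) ≈ᵖ expPower q n
    exp-xt-⟨⟩ n = begin
      exp-xt n ⟨ q ⟩                      ≈⟨ ⟨⟩-· q (1/ (n !)) (X ^ᵖ n) ⟩
      (1/ (n !)) · ((X ^ᵖ n) ⟨ q ⟩)       ≈⟨ ·-cong {p = (X ^ᵖ n) ⟨ q ⟩} {q ^ᵖ n} refl (⟨⟩-^ n) ⟩
      expPower q n                        ∎

    ⟨⟩-∑ : ∀ n f → (∑ᵖ-below n f ⟨ q ⟩) ≈ᵖ ∑ᵖ-below n (λ i → f i ⟨ q ⟩)
    ⟨⟩-∑ zero    f = P.refl {[]}
    ⟨⟩-∑ (suc n) f = begin
      (f 0 +ᵖ ∑ᵖ-below n (λ i → f (suc i))) ⟨ q ⟩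
        ≈⟨ ⟨⟩-+ q (f 0) (∑ᵖ-below n λ i → f (suc i)) ⟩
      f 0 ⟨ q ⟩ +ᵖ ∑ᵖ-below n (λ i → f (suc i)) ⟨ q ⟩
        ≈⟨ P.+-congˡ {f 0 ⟨ q ⟩} {∑ᵖ-below n (λ i → f (suc i)) ⟨ q ⟩} {∑ᵖ-below n (λ i → f (suc i) ⟨ q ⟩)}
             (⟨⟩-∑ n λ i → f (suc i)) ⟩
      f 0 ⟨ q ⟩ +ᵖ ∑ᵖ-below n (λ i → f (suc i) ⟨ q ⟩) ∎

    embed-*-⟨⟩ : ∀ f F n → ((embed f *ᵗ F) n ⟨ q ⟩) ≈ᵖ (embed f *ᵗ (λ m → F m ⟨ q ⟩)) n
    embed-*-⟨⟩ f F n = begin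
      (embed f *ᵗ F) n ⟨ q ⟩
        ≈⟨ ⟨⟩-∑ (suc n) (λ i → C (f i) *ᵖ F (n ∸ i)) ⟩
      ∑ᵖ-below (suc n) (λ i → (C (f i) *ᵖ F (n ∸ i)) ⟨ q ⟩)
        ≈⟨ ∑ᵖ.∑-cong (suc n) {λ i → (C (f i) *ᵖ F (n ∸ i)) ⟨ q ⟩} {λ i → C (f i) *ᵖ F (n ∸ i) ⟨ q ⟩} (λ i _ → begin
             (C (f i) *ᵖ F (n ∸ i)) ⟨ q ⟩
               ≈⟨ ⟨⟩-* q (C (f i)) (F (n ∸ i)) ⟩
             C (f i) ⟨ q ⟩ *ᵖ F (n ∸ i) ⟨ q ⟩
               ≈⟨ P.*-congʳ {F (n ∸ i) ⟨ q ⟩} {C (f i) ⟨ q ⟩} {C (f i)} (⟨⟩-C q (f i)) ⟩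
             C (f i) *ᵖ F (n ∸ i) ⟨ q ⟩ ∎) ⟩
      (embed f *ᵗ (λ m → F m ⟨ q ⟩)) n ∎

  -- The coefficients of bʳ are constants, so substitution acts on eˣᵗ alone and yields the factor
  -- e⁻ᵗ. This matches the bʳ e⁻ᵗ left by differentiating the poly-Bernoulli series.
  𝔹-⟨X-1⟩ : ∀ r n → (𝔹 r n ⟨ X-1 ⟩)
              ≈ᵖ egfCoeff (embed ((bernoulliSeries ^ˢ r) *ˢ exp (- 1#)) *ᵗ exp-xt) n
  𝔹-⟨X-1⟩ r n = begin
    𝔹 r n ⟨ X-1 ⟩
      ≈⟨ ⟨⟩-· X-1 (fromℕ (n !)) ((embed β *ᵗ exp-xt) n) ⟩
    fromℕ (n !) · ((embed β *ᵗ exp-xt) n ⟨ X-1 ⟩)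
      ≈⟨ ·-cong {p = (embed β *ᵗ exp-xt) n ⟨ X-1 ⟩} {(embed (β *ˢ e⁻) *ᵗ exp-xt) n} refl shifted ⟩
    fromℕ (n !) · ((embed (β *ˢ e⁻) *ᵗ exp-xt) n) ∎
    where
    β = bernoulliSeries ^ˢ r
    e⁻ = exp (- 1#)
    shifted : ((embed β *ᵗ exp-xt) n ⟨ X-1 ⟩) ≈ᵖ (embed (β *ˢ e⁻) *ᵗ exp-xt) n
    shifted = begin
      (embed β *ᵗ exp-xt) n ⟨ X-1 ⟩
        ≈⟨ embed-*-⟨⟩ X-1 β exp-xt n ⟩
      (embed β *ᵗ (λ m → exp-xt m ⟨ X-1 ⟩)) n
        ≈⟨ T.*ˢ-cong (embed β) (embed β) (λ m → exp-xt m ⟨ X-1 ⟩) (embed e⁻ *ᵗ exp-xt) (λ m → P.refl {embed β m})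
             (λ m → P.trans {exp-xt m ⟨ X-1 ⟩} {expPower X-1 m} {(embed e⁻ *ᵗ exp-xt) m} (exp-xt-⟨⟩ X-1 m) (expPower-X-1 m)) n ⟩
      (embed β *ᵗ (embed e⁻ *ᵗ exp-xt)) n
        ≈⟨ T.*ˢ-assoc (embed β) (embed e⁻) exp-xt n ⟨
      ((embed β *ᵗ embed e⁻) *ᵗ exp-xt) n
        ≈⟨ T.*ˢ-cong (embed (β *ˢ e⁻)) (embed β *ᵗ embed e⁻) exp-xt exp-xt (embed-* β e⁻) (λ m → P.refl {exp-xt m}) n ⟨
      (embed (β *ˢ e⁻) *ᵗ exp-xt) n ∎

  ·-· : ∀ a b p → (a · (b · p)) ≈ᵖ ((a * b) · p)
  ·-· a b p n = trans (coeff-· a (b · p) n) (trans (*-congˡ (coeff-· b p n))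
    (trans (sym (*-assoc a b _)) (sym (coeff-· (a * b) p n))))

  egfCoeff-* : ∀ g F n → egfCoeff (embed g *ᵗ F) n
    ≈ᵖ ∑ᵖ-below (suc n) (λ l → (fromℕ (binom n l) * (fromℕ ((n ∸ l) !) * g (n ∸ l))) · egfCoeff F l)
  egfCoeff-* g F n = begin
    fromℕ (n !) · (embed g *ᵗ F) n
      ≈⟨ ·≈C* (fromℕ (n !)) ((embed g *ᵗ F) n) ⟩
    C (fromℕ (n !)) *ᵖ (embed g *ᵗ F) n
      -- The Cauchy product indexes by its left factor, whereas the recurrence is indexed by the
      -- degree l of the polynomial factor.
      ≈⟨ P.*-congˡ {C (fromℕ (n !))} {(embed g *ᵗ F) n} {(F *ᵗ embed g) n} (T.*ˢ-comm (embed g) F n) ⟩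
    C (fromℕ (n !)) *ᵖ (F *ᵗ embed g) n
      ≈⟨ ∑ᵖ.*-distribˡ-∑ (suc n) (C (fromℕ (n !))) (λ l → F l *ᵖ C (g (n ∸ l))) ⟩
    ∑ᵖ-below (suc n) (λ l → C (fromℕ (n !)) *ᵖ (F l *ᵖ C (g (n ∸ l))))
      ≈⟨ ∑ᵖ.∑-cong (suc n) {λ l → C (fromℕ (n !)) *ᵖ (F l *ᵖ C (g (n ∸ l)))}
           {λ l → (fromℕ (binom n l) * (fromℕ ((n ∸ l) !) * g (n ∸ l))) · egfCoeff F l}
           (λ l l≤n → term l (ℕ.s≤s⁻¹ l≤n)) ⟩
    ∑ᵖ-below (suc n) (λ l → (fromℕ (binom n l) * (fromℕ ((n ∸ l) !) * g (n ∸ l))) · egfCoeff F l) ∎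
    where
    scalars : ∀ l → l ≤ n → fromℕ (n !) * g (n ∸ l)
                            ≈ fromℕ (binom n l) * (fromℕ ((n ∸ l) !) * g (n ∸ l)) * fromℕ (l !)
    scalars l l≤n rewrite n!≡nCk*k!*[n∸k]! l≤n = trans
      (*-congʳ (trans (fromℕ-* (binom n l) (l ! ℕ.* (n ∸ l) !)) (*-congˡ (fromℕ-* (l !) ((n ∸ l) !)))))
      (solve 4 (λ b f f′ x → b :* (f :* f′) :* x := b :* (f′ :* x) :* f) refl
        (fromℕ (binom n l)) (fromℕ (l !)) (fromℕ ((n ∸ l) !)) (g (n ∸ l)))
    term : ∀ l → l ≤ n → (C (fromℕ (n !)) *ᵖ (F l *ᵖ C (g (n ∸ l))))
                         ≈ᵖ ((fromℕ (binom n l) * (fromℕ ((n ∸ l) !) * g (n ∸ l))) · egfCoeff F l)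
    term l l≤n = begin
      C (fromℕ (n !)) *ᵖ (F l *ᵖ C (g (n ∸ l)))
        ≈⟨ P.*-congˡ {C (fromℕ (n !))} {F l *ᵖ C (g (n ∸ l))} {C (g (n ∸ l)) *ᵖ F l} (P.*-comm (F l) (C (g (n ∸ l)))) ⟩
      C (fromℕ (n !)) *ᵖ (C (g (n ∸ l)) *ᵖ F l)
        ≈⟨ P.*-congˡ {C (fromℕ (n !))} {g (n ∸ l) · F l} {C (g (n ∸ l)) *ᵖ F l} (·≈C* (g (n ∸ l)) (F l)) ⟨
      C (fromℕ (n !)) *ᵖ (g (n ∸ l) · F l)
        ≈⟨ ·≈C* (fromℕ (n !)) (g (n ∸ l) · F l) ⟨
      fromℕ (n !) · (g (n ∸ l) · F l)
        ≈⟨ ·-· (fromℕ (n !)) (g (n ∸ l)) (F l) ⟩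
      (fromℕ (n !) * g (n ∸ l)) · F l
        ≈⟨ ·-cong {p = F l} {F l} (scalars l l≤n) (P.refl {F l}) ⟩
      (fromℕ (binom n l) * (fromℕ ((n ∸ l) !) * g (n ∸ l)) * fromℕ (l !)) · F l
        ≈⟨ ·-· (fromℕ (binom n l) * (fromℕ ((n ∸ l) !) * g (n ∸ l))) (fromℕ (l !)) (F l) ⟨
      (fromℕ (binom n l) * (fromℕ ((n ∸ l) !) * g (n ∸ l))) · egfCoeff F l ∎

  -- Source of the denominators (n+1-l)(n-l): the coefficient of e₂ in degree j, times j!, is
  -- j!/(j+2)!, taken at j = n-1-l.
  !-*-expQuotient₂ : ∀ n → fromℕ (n !) * expQuotient₂ n ≈ 1/ (suc (suc n) ℕ.* suc n)
  !-*-expQuotient₂ n rewrite [n+2]!≡n!*[n+2]*[n+1] n = fromℕ-*-1/ (n !) (suc (suc n) ℕ.* suc n) {{n !≢0}}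

  module _ (n : ℕ) (r k : ℤ) where
    private
      F F₊ H : K[x]⟦t⟧.Series
      F  = embed (mixed r k) *ᵗ exp-xt
      F₊ = embed (mixed (r ℤ.+ 1ℤ) k) *ᵗ exp-xt
      H  = embed ((bernoulliSeries ^ˢ r) *ˢ exp (- 1#)) *ᵗ exp-xt
      u v : Polynomial
      u = (embed expQuotient₂ *ᵗ F₊) n
      v = (embed (derivedSeries k) *ᵗ H) n
      ρ : Carrier
      ρ = fromℤ r
      M : Carrier
      M = fromℕ (n !)

    ∂-mixed-exp-xt : (T.∂ F n +ᵖ C ρ *ᵖ F n) ≈ᵖ (C ρ *ᵖ u +ᵖ v +ᵖ X *ᵖ F n)
    ∂-mixed-exp-xt = begin
      T.∂ F n +ᵖ C ρ *ᵖ F n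
        ≈⟨ P.+-congˡ {T.∂ F n} {(cρ *ᵗ F) n} {C ρ *ᵖ F n} (T.constant-*ˢ (C ρ) F n) ⟨
      T.∂ F n +ᵖ (cρ *ᵗ F) n
        ≈⟨ ∂ᵗ.∂-*-exponential {embed (mixed r k)} {cρ} {embed expQuotient₂} {embed (mixed (r ℤ.+ 1ℤ) k)}
             {embed (derivedSeries k)} {embed ((bernoulliSeries ^ˢ r) *ˢ exp (- 1#))} {exp-xt} {K[x]⟦t⟧.constant X}
             (∂-embed-mixed r k) ∂-exp-xt n ⟩
      (cρ *ᵗ (embed expQuotient₂ *ᵗ F₊)) n +ᵖ v +ᵖ (K[x]⟦t⟧.constant X *ᵗ F) n
        ≈⟨ P.+-cong {(cρ *ᵗ (embed expQuotient₂ *ᵗ F₊)) n +ᵖ v} {C ρ *ᵖ u +ᵖ v} {(K[x]⟦t⟧.constant X *ᵗ F) n} {X *ᵖ F n}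
             (P.+-congʳ {v} {(cρ *ᵗ (embed expQuotient₂ *ᵗ F₊)) n} {C ρ *ᵖ u} (T.constant-*ˢ (C ρ) (embed expQuotient₂ *ᵗ F₊) n))
             (T.constant-*ˢ X F n) ⟩
      C ρ *ᵖ u +ᵖ v +ᵖ X *ᵖ F n ∎
      where cρ = K[x]⟦t⟧.constant (C ρ)

    -- Splitting (n+1)! as n! (n+1) hands the factor n + 1 to the derivative in t.
    s-suc : s r k (suc n) ≈ᵖ (M · T.∂ F n)
    s-suc m = trans (coeff-· (fromℕ (suc n !)) (F (suc n)) m)
      (trans (*-congʳ (trans (fromℕ-* (suc n) (n !)) (*-comm _ _)))
      (trans (*-assoc _ _ _)
      (trans (*-congˡ (trans (fromℕ-*-× (suc n) (coeff (F (suc n)) m)) (sym (coeff-× (suc n) (F (suc n)) m))))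
      (sym (coeff-· M (T.∂ F n) m)))))

    expSum polyBernoulliSum : Polynomial
    expSum = ∑ᵖ-below (suc n) λ l →
      (fromℕ (binom n l) * (1/ ((suc (suc n) ∸ l) ℕ.* (suc n ∸ l)))) · s (r ℤ.+ 1ℤ) k l
    polyBernoulliSum = ∑ᵖ-below (suc n) λ l →
      ((- 1#) ^ (n ∸ l) * fromℕ (binom n l)
        * (∑-below (suc n ∸ l) λ m →
             (- 1#) ^ m * (fromℕ (suc m !) * (suc (suc m) ^ᶻ (ℤ.- k))) * fromℕ (S₂ (n ∸ l) m)))
      · (𝔹 r l ⟨ X-1 ⟩)

    expSum-correct : (M · u) ≈ᵖ expSum
    expSum-correct = begin
      M · u
        ≈⟨ egfCoeff-* expQuotient₂ F₊ n ⟩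
      ∑ᵖ-below (suc n) (λ l → (fromℕ (binom n l) * (fromℕ ((n ∸ l) !) * expQuotient₂ (n ∸ l))) · s (r ℤ.+ 1ℤ) k l)
        ≈⟨ ∑ᵖ.∑-cong (suc n)
             {λ l → (fromℕ (binom n l) * (fromℕ ((n ∸ l) !) * expQuotient₂ (n ∸ l))) · s (r ℤ.+ 1ℤ) k l}
             {λ l → (fromℕ (binom n l) * (1/ ((suc (suc n) ∸ l) ℕ.* (suc n ∸ l)))) · s (r ℤ.+ 1ℤ) k l}
             (λ l l≤n → ·-cong {p = s (r ℤ.+ 1ℤ) k l} {s (r ℤ.+ 1ℤ) k l}
                (*-congˡ (scalar l (ℕ.s≤s⁻¹ l≤n))) (P.refl {s (r ℤ.+ 1ℤ) k l})) ⟩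
      expSum ∎
      where
      scalar : ∀ l → l ≤ n → fromℕ ((n ∸ l) !) * expQuotient₂ (n ∸ l) ≈ 1/ ((suc (suc n) ∸ l) ℕ.* (suc n ∸ l))
      -- Truncated subtraction releases its successors only with l ≤ n at hand; afterwards both
      -- factors are successors of `n ∸ l`.
      scalar l l≤n rewrite ℕ.+-∸-assoc 2 l≤n | ℕ.+-∸-assoc 1 l≤n = !-*-expQuotient₂ (n ∸ l)

    polyBernoulliSum-correct : (M · v) ≈ᵖ polyBernoulliSum
    polyBernoulliSum-correct = begin
      M · v
        ≈⟨ egfCoeff-* (derivedSeries k) H n ⟩
      ∑ᵖ-below (suc n) (λ l → (fromℕ (binom n l) * (fromℕ ((n ∸ l) !) * derivedSeries k (n ∸ l))) · egfCoeff H l)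
        ≈⟨ ∑ᵖ.∑-cong (suc n)
             {λ l → (fromℕ (binom n l) * (fromℕ ((n ∸ l) !) * derivedSeries k (n ∸ l))) · egfCoeff H l}
             {λ l → ((- 1#) ^ (n ∸ l) * fromℕ (binom n l) * ∑-below (suc n ∸ l) (summand l)) · (𝔹 r l ⟨ X-1 ⟩)}
             (λ l l≤n → ·-cong {p = egfCoeff H l} {𝔹 r l ⟨ X-1 ⟩} (scalar l (ℕ.s≤s⁻¹ l≤n))
                (P.sym {𝔹 r l ⟨ X-1 ⟩} {egfCoeff H l} (𝔹-⟨X-1⟩ r l))) ⟩
      polyBernoulliSum ∎
      where
      summand : ℕ → ℕ → Carrier
      summand l m = (- 1#) ^ m * (fromℕ (suc m !) * (suc (suc m) ^ᶻ (ℤ.- k))) * fromℕ (S₂ (n ∸ l) m)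
      scalar : ∀ l → l ≤ n → fromℕ (binom n l) * (fromℕ ((n ∸ l) !) * derivedSeries k (n ∸ l))
                 ≈ (- 1#) ^ (n ∸ l) * fromℕ (binom n l) * ∑-below (suc n ∸ l) (summand l)
      scalar l l≤n rewrite ℕ.+-∸-assoc 1 l≤n = trans (*-congˡ (!-*-derivedSeries k (n ∸ l)))
        (solve 3 (λ b σ x → b :* (σ :* x) := σ :* b :* x) refl
          (fromℕ (binom n l)) ((- 1#) ^ (n ∸ l)) (∑-below (suc (n ∸ l)) (summand l)))

    s-recurrence : s r k (suc n) ≈ᵖ ((- ρ) · s r k n +ᵖ ρ · expSum +ᵖ polyBernoulliSum +ᵖ X *ᵖ s r k n)
    s-recurrence = begin
      s r k (suc n)
        ≈⟨ s-suc ⟩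
      M · T.∂ F n
        ≈⟨ ·≈C* M (T.∂ F n) ⟩
      C M *ᵖ T.∂ F n
        ≈⟨ scale-equation polynomialCommutativeRing (C M) (C ρ) X (T.∂ F n) (F n) u v ∂-mixed-exp-xt ⟩
      -- Negation acts on the coefficient list, so the negative of `C ρ` is `C (- ρ)` by
      -- computation.
      C (- ρ) *ᵖ MF +ᵖ C ρ *ᵖ (C M *ᵖ u) +ᵖ C M *ᵖ v +ᵖ X *ᵖ MF
        ≈⟨ P.+-cong {C (- ρ) *ᵖ MF +ᵖ C ρ *ᵖ (C M *ᵖ u) +ᵖ C M *ᵖ v} {(- ρ) · s r k n +ᵖ ρ · expSum +ᵖ polyBernoulliSum} {X *ᵖ MF} {X *ᵖ s r k n}
             (P.+-cong {C (- ρ) *ᵖ MF +ᵖ C ρ *ᵖ (C M *ᵖ u)} {(- ρ) · s r k n +ᵖ ρ · expSum} {C M *ᵖ v} {polyBernoulliSum}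
               (P.+-cong {C (- ρ) *ᵖ MF} {(- ρ) · s r k n} {C ρ *ᵖ (C M *ᵖ u)} {ρ · expSum}
                 (C*C* (- ρ) (F n) (s r k n) (P.refl {s r k n})) (C*C* ρ u expSum expSum-correct))
               (P.trans {C M *ᵖ v} {M · v} {polyBernoulliSum} (P.sym {M · v} {C M *ᵖ v} (·≈C* M v)) polyBernoulliSum-correct))
             (P.*-congˡ {X} {MF} {s r k n} (P.sym {s r k n} {MF} (·≈C* M (F n)))) ⟩
      (- ρ) · s r k n +ᵖ ρ · expSum +ᵖ polyBernoulliSum +ᵖ X *ᵖ s r k n ∎
      where
      MF = C M *ᵖ F n
      C*C* : ∀ x p p′ → (M · p) ≈ᵖ p′ → (C x *ᵖ (C M *ᵖ p)) ≈ᵖ (x · p′)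
      C*C* x p p′ Mp≈p′ = begin
        C x *ᵖ (C M *ᵖ p)   ≈⟨ P.*-congˡ {C x} {M · p} {C M *ᵖ p} (·≈C* M p) ⟨
        C x *ᵖ (M · p)      ≈⟨ ·≈C* x (M · p) ⟨
        x · (M · p)         ≈⟨ ·-cong {p = M · p} {p′} refl Mp≈p′ ⟩
        x · p′              ∎

theorem4 : ∀ {c ℓ₁ ℓ₂} (K : HeytingField c ℓ₁ ℓ₂) (char0 : CharacteristicZero K) →
    let open MixedType K char0 in
    ∀ (n : ℕ) → n ≥ 1 → (r k : ℤ) →
    s r k n
    ≈ᵖ (- fromℤ r) · s r k (n ∸ 1)
    +ᵖ fromℤ r · (∑ᵖ[ l < n ]
    ((fromℕ (binom (n ∸ 1) l) * (1/ ((suc n ∸ l) ℕ.* (n ∸ l)))) · s (r ℤ.+ 1ℤ) k l))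
    +ᵖ (∑ᵖ[ l < n ]
    (((- 1#) ^ (n ∸ 1 ∸ l) * fromℕ (binom (n ∸ 1) l)
    * (∑[ m < n ∸ l ]
    ((- 1#) ^ m * (fromℕ (suc m !) * (suc (suc m) ^ᶻ (ℤ.- k)))
    * fromℕ (S₂ (n ∸ 1 ∸ l) m))))
    · (𝔹 r l ⟨ X +ᵖ C (- 1#) ⟩)))
    +ᵖ X *ᵖ s r k (n ∸ 1)
-- With the index written as `suc n`, each `suc n ∸ 1` reduces to `n`, and the two statements agree
-- by computation.
theorem4 K char0 (suc n) n≥1 r k = s-recurrence n r k
  where open PolynomialSeries K char0
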